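{- Let $\alpha$ be a monotone unbalanced connective whose characteristic polynomial $A_\alpha$ has a fixed-point $t\in(0,1)$, and let the support of $\mu$ consist only of the $n$ projections. Then the limiting distribution of the growth process $(\mu,\alpha)$ is concentrated on the threshold function $T_{\lceil tn\rceil}(x_1,\dots,x_n)$.
   Context: A connective is a $k$-adic Boolean function $\alpha:\{0,1\}^k\to\{0,1\}$; it is balanced if it takes the value 1 on exactly half of its inputs, and unbalanced otherwise. Its characteristic polynomial is $A_\alpha(p)=\Pr[\alpha(X_1,\dots,X_k)=1]=\sum_{j=0}^k\beta_j\binom kj p^j(1-p)^{k-j}$, where the $X_j$ are independent binary variables each equal to 1 with probability $p$, and $\beta_j$ is the fraction of assignments of weight $j$ for which $\alpha$ is true. The initial distribution $\mu$ is uniform on its support, here the projections $x_1,\dots,x_n$. The growth process $(\mu,\alpha)$ gives distributions $\pi_i$ on $n$-adic Boolean functions: $\pi_0=\mu$, and for $i\ge1$, $\pi_i(f)$ is the probability that $\alpha(g_1,\dots,g_k)=f$ where $g_1,\dots,g_k$ are independent random functions distributed according to $\pi_{i-1}$. The limiting distribution is $\pi=\lim_{i\to\infty}\pi_i$ (pointwise); it is concentrated on $f$ if $\pi(f)=1$. The threshold function $T_m(x_1,\dots,x_n)$ is 1 if and only if at least $m$ of its $n$ arguments are 1. -}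

module Defs where

open import Data.Bool.Base as Bool using (Bool; true; false; if_then_else_)
import Data.Bool.Properties as Bool
open import Data.Fin.Base using (Fin)
open import Data.Fin.Properties using (any?)
open import Data.Integer.Base as ℤ using (ℤ; +_)
open import Data.List.Base
  using (List; []; _∷_; foldr; map; filter; length; cartesianProductWith)
open import Data.List.Membership.Propositional using (_∈_)
open import Data.List.Membership.Propositional.Properties using (∈-cartesianProductWith⁺)
import Data.List.Relation.Unary.All as All
open import Data.List.Relation.Unary.Any using (here; there)
open import Data.Nat.Base as ℕ using (ℕ; zero; suc)
import Data.Nat.Properties as ℕ
open import Data.Product.Base using (∃-syntax; _×_; _,_; proj₁; proj₂)
open import Data.Rational.Base as ℚ using (ℚ; 0ℚ; 1ℚ; ½; ∣_∣)
import Data.Rational.Properties as ℚ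
open import Data.Rational.Solver using (module +-*-Solver)
open import Data.Vec.Base as Vec using (Vec; []; _∷_)
open import Data.Vec.Relation.Binary.Pointwise.Inductive using (Pointwise)
open import Relation.Binary.PropositionalEquality
open import Relation.Nullary using (¬_; Dec; does)
open import Relation.Nullary.Decidable using (map′)

------------------------------------------------------------------------
-- Real numbers: Cauchy sequences of rationals, compared up to _≃ℝ_

IsCauchy : (ℕ → ℚ) → Set
IsCauchy x = ∀ ε → 0ℚ ℚ.< ε →
  ∃[ N ] (∀ i j → N ℕ.≤ i → N ℕ.≤ j → ∣ x i ℚ.- x j ∣ ℚ.< ε)

record ℝ : Set where
  constructor mkℝ
  field
    seq    : ℕ → ℚ
    cauchy : IsCauchy seq

open ℝ public

infix 4 _≃ℝ_ _<ℝ_ _≤ℝ_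

_≃ℝ_ : ℝ → ℝ → Set
x ≃ℝ y = ∀ ε → 0ℚ ℚ.< ε →
  ∃[ N ] (∀ i → N ℕ.≤ i → ∣ seq x i ℚ.- seq y i ∣ ℚ.< ε)

_<ℝ_ : ℝ → ℝ → Set
x <ℝ y = ∃[ ε ] (0ℚ ℚ.< ε ×
  ∃[ N ] (∀ i → N ℕ.≤ i → seq x i ℚ.+ ε ℚ.< seq y i))

_≤ℝ_ : ℝ → ℝ → Set
x ≤ℝ y = ¬ (y <ℝ x)

private
  +-cauchy : ∀ {x y} → IsCauchy x → IsCauchy y → IsCauchy (λ i → x i ℚ.+ y i)
  +-cauchy {x} {y} cx cy ε 0<ε
    with cx (½ ℚ.* ε) 0<½ε | cy (½ ℚ.* ε) 0<½ε
    where
    0<½ε : 0ℚ ℚ.< ½ ℚ.* ε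
    0<½ε = subst (ℚ._< ½ ℚ.* ε) (ℚ.*-zeroʳ ½) (ℚ.*-monoʳ-<-pos ½ 0<ε)
  ... | M , p | N , q = M ℕ.⊔ N , λ i j i≥ j≥ → begin-strict
    ∣ (x i ℚ.+ y i) ℚ.- (x j ℚ.+ y j) ∣      ≡⟨ cong ∣_∣ (rearrange (x i) (y i) (x j) (y j)) ⟩
    ∣ (x i ℚ.- x j) ℚ.+ (y i ℚ.- y j) ∣      ≤⟨ ℚ.∣p+q∣≤∣p∣+∣q∣ (x i ℚ.- x j) (y i ℚ.- y j) ⟩
    ∣ x i ℚ.- x j ∣ ℚ.+ ∣ y i ℚ.- y j ∣      <⟨ ℚ.+-mono-< (p i j (ℕ.m⊔n≤o⇒m≤o M N i≥) (ℕ.m⊔n≤o⇒m≤o M N j≥))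
                                                           (q i j (ℕ.m⊔n≤o⇒n≤o M N i≥) (ℕ.m⊔n≤o⇒n≤o M N j≥)) ⟩
    ½ ℚ.* ε ℚ.+ ½ ℚ.* ε                      ≡⟨ ℚ.*-distribʳ-+ ε ½ ½ ⟨
    1ℚ ℚ.* ε                                 ≡⟨ ℚ.*-identityˡ ε ⟩
    ε                                        ∎
    where
    open ℚ.≤-Reasoning
    rearrange : ∀ a b c d → (a ℚ.+ b) ℚ.- (c ℚ.+ d) ≡ (a ℚ.- c) ℚ.+ (b ℚ.- d)
    rearrange = solve 4 (λ a b c d → (a :+ b) :+ (:- (c :+ d)) := (a :+ (:- c)) :+ (b :+ (:- d))) refl
      where open +-*-Solver

  neg-cauchy : ∀ {x} → IsCauchy x → IsCauchy (λ i → ℚ.- x i)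
  neg-cauchy {x} cx ε 0<ε with cx ε 0<ε
  ... | N , p = N , λ i j i≥ j≥ → subst (ℚ._< ε)
    (trans (sym (ℚ.∣-p∣≡∣p∣ (x i ℚ.- x j))) (cong ∣_∣ (ℚ.neg-distrib-+ (x i) (ℚ.- x j))))
    (p i j i≥ j≥)

  bounded : ∀ {x} → IsCauchy x →
    ∃[ B ] (0ℚ ℚ.< B × ∃[ N ] (∀ i → N ℕ.≤ i → ∣ x i ∣ ℚ.≤ B))
  bounded {x} cx with cx 1ℚ (ℚ.positive⁻¹ 1ℚ)
  ... | N , p = 1ℚ ℚ.+ ∣ x N ∣
              , ℚ.+-mono-<-≤ (ℚ.positive⁻¹ 1ℚ) (ℚ.0≤∣p∣ (x N))
              , N , λ i i≥ → begin
    ∣ x i ∣                          ≡⟨ cong ∣_∣ (split (x i) (x N)) ⟩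
    ∣ (x i ℚ.- x N) ℚ.+ x N ∣        ≤⟨ ℚ.∣p+q∣≤∣p∣+∣q∣ (x i ℚ.- x N) (x N) ⟩
    ∣ x i ℚ.- x N ∣ ℚ.+ ∣ x N ∣      ≤⟨ ℚ.+-monoˡ-≤ ∣ x N ∣ (ℚ.<⇒≤ (p i N i≥ ℕ.≤-refl)) ⟩
    1ℚ ℚ.+ ∣ x N ∣                   ∎
    where
    open ℚ.≤-Reasoning
    split : ∀ a b → a ≡ (a ℚ.- b) ℚ.+ b
    split = solve 2 (λ a b → a := (a :+ (:- b)) :+ b) refl
      where open +-*-Solver

  scale : ∀ {D ε} → 0ℚ ℚ.< D → 0ℚ ℚ.< ε → ∃[ δ ] (0ℚ ℚ.< δ × D ℚ.* δ ≡ ε)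
  scale {D} {ε} 0<D 0<ε = 1/D ℚ.* ε , 0<1/D*ε , (begin
    D ℚ.* (1/D ℚ.* ε)    ≡⟨ ℚ.*-assoc D 1/D ε ⟨
    D ℚ.* 1/D ℚ.* ε      ≡⟨ cong (ℚ._* ε) (ℚ.*-inverseʳ D) ⟩
    1ℚ ℚ.* ε             ≡⟨ ℚ.*-identityˡ ε ⟩
    ε                    ∎)
    where
    open ≡-Reasoning
    instance
      D-pos = ℚ.positive 0<D
      D-nonZero = ℚ.pos⇒nonZero D
    1/D : ℚ
    1/D = ℚ.1/ D
    0<1/D*ε : 0ℚ ℚ.< 1/D ℚ.* ε
    0<1/D*ε = subst (ℚ._< 1/D ℚ.* ε) (ℚ.*-zeroʳ 1/D)
      (ℚ.*-monoʳ-<-pos 1/D {{ℚ.1/pos⇒pos D}} 0<ε)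

  *-split : ∀ a b c d → a ℚ.* b ℚ.- c ℚ.* d ≡ a ℚ.* (b ℚ.- d) ℚ.+ d ℚ.* (a ℚ.- c)
  *-split a b c d = sym (begin
    a ℚ.* (b ℚ.- d) ℚ.+ d ℚ.* (a ℚ.- c)
      ≡⟨ cong₂ ℚ._+_ (*-distribˡ-- a b d) (*-distribˡ-- d a c) ⟩
    (a ℚ.* b ℚ.- a ℚ.* d) ℚ.+ (d ℚ.* a ℚ.- d ℚ.* c)
      ≡⟨ cong₂ (λ u v → (a ℚ.* b ℚ.- a ℚ.* d) ℚ.+ (u ℚ.- v)) (ℚ.*-comm d a) (ℚ.*-comm d c) ⟩
    (a ℚ.* b ℚ.- a ℚ.* d) ℚ.+ (a ℚ.* d ℚ.- c ℚ.* d)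
      ≡⟨ telescope (a ℚ.* b) (a ℚ.* d) (c ℚ.* d) ⟩
    a ℚ.* b ℚ.- c ℚ.* d ∎)
    where
    open ≡-Reasoning
    *-distribˡ-- : ∀ u v w → u ℚ.* (v ℚ.- w) ≡ u ℚ.* v ℚ.- u ℚ.* w
    *-distribˡ-- u v w = trans (ℚ.*-distribˡ-+ u v (ℚ.- w))
      (cong (u ℚ.* v ℚ.+_) (sym (ℚ.neg-distribʳ-* u w)))
    telescope : ∀ u v w → (u ℚ.- v) ℚ.+ (v ℚ.- w) ≡ u ℚ.- w
    telescope = solve 3 (λ u v w → (u :+ (:- v)) :+ (v :+ (:- w)) := u :+ (:- w)) refl
      where open +-*-Solver

  *-small : ∀ {E δ a b} → 0ℚ ℚ.< E → ∣ a ∣ ℚ.≤ E → ∣ b ∣ ℚ.< δ → ∣ a ℚ.* b ∣ ℚ.< E ℚ.* δ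
  *-small {E} {δ} {a} {b} 0<E a≤E b<δ = begin-strict
    ∣ a ℚ.* b ∣        ≡⟨ ℚ.∣p*q∣≡∣p∣*∣q∣ a b ⟩
    ∣ a ∣ ℚ.* ∣ b ∣    ≤⟨ ℚ.*-monoʳ-≤-nonNeg ∣ b ∣ {{ℚ.nonNegative (ℚ.0≤∣p∣ b)}} a≤E ⟩
    E ℚ.* ∣ b ∣        <⟨ ℚ.*-monoʳ-<-pos E {{ℚ.positive 0<E}} b<δ ⟩
    E ℚ.* δ            ∎
    where open ℚ.≤-Reasoning

  *-close : ∀ {B C δ} a b c d → 0ℚ ℚ.< B → 0ℚ ℚ.< C → ∣ a ∣ ℚ.≤ B → ∣ d ∣ ℚ.≤ C →
    ∣ a ℚ.- c ∣ ℚ.< δ → ∣ b ℚ.- d ∣ ℚ.< δ → ∣ a ℚ.* b ℚ.- c ℚ.* d ∣ ℚ.< (B ℚ.+ C) ℚ.* δ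
  *-close {B} {C} {δ} a b c d 0<B 0<C a≤B d≤C a-c<δ b-d<δ = begin-strict
    ∣ a ℚ.* b ℚ.- c ℚ.* d ∣
      ≡⟨ cong ∣_∣ (*-split a b c d) ⟩
    ∣ a ℚ.* (b ℚ.- d) ℚ.+ d ℚ.* (a ℚ.- c) ∣
      ≤⟨ ℚ.∣p+q∣≤∣p∣+∣q∣ (a ℚ.* (b ℚ.- d)) (d ℚ.* (a ℚ.- c)) ⟩
    ∣ a ℚ.* (b ℚ.- d) ∣ ℚ.+ ∣ d ℚ.* (a ℚ.- c) ∣
      <⟨ ℚ.+-mono-< (*-small {B} {δ} {a} {b ℚ.- d} 0<B a≤B b-d<δ)
                    (*-small {C} {δ} {d} {a ℚ.- c} 0<C d≤C a-c<δ) ⟩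
    B ℚ.* δ ℚ.+ C ℚ.* δ
      ≡⟨ ℚ.*-distribʳ-+ δ B C ⟨
    (B ℚ.+ C) ℚ.* δ ∎
    where open ℚ.≤-Reasoning

  0<+ : ∀ {B C} → 0ℚ ℚ.< B → 0ℚ ℚ.< C → 0ℚ ℚ.< B ℚ.+ C
  0<+ {B} {C} 0<B 0<C =
    ℚ.<-trans 0<B (subst (ℚ._< B ℚ.+ C) (ℚ.+-identityʳ B) (ℚ.+-monoʳ-< B 0<C))

  *-cauchy-bounded : ∀ {x y B C K L} → IsCauchy x → IsCauchy y → 0ℚ ℚ.< B → 0ℚ ℚ.< C →
    (∀ i → K ℕ.≤ i → ∣ x i ∣ ℚ.≤ B) → (∀ i → L ℕ.≤ i → ∣ y i ∣ ℚ.≤ C) →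
    IsCauchy (λ i → x i ℚ.* y i)
  *-cauchy-bounded {x} {y} {B} {C} {K} {L} cx cy 0<B 0<C x≤B y≤C ε 0<ε =
    (M ℕ.⊔ N) ℕ.⊔ (K ℕ.⊔ L) , λ i j i≥ j≥ →
    subst (∣ x i ℚ.* y i ℚ.- x j ℚ.* y j ∣ ℚ.<_) [B+C]δ≡ε
      (*-close {B} {C} {δ} (x i) (y i) (x j) (y j) 0<B 0<C
        (x≤B i (ℕ.m⊔n≤o⇒m≤o K L (ℕ.m⊔n≤o⇒n≤o (M ℕ.⊔ N) (K ℕ.⊔ L) i≥)))
        (y≤C j (ℕ.m⊔n≤o⇒n≤o K L (ℕ.m⊔n≤o⇒n≤o (M ℕ.⊔ N) (K ℕ.⊔ L) j≥)))
        (p i j (ℕ.m⊔n≤o⇒m≤o M N (ℕ.m⊔n≤o⇒m≤o (M ℕ.⊔ N) (K ℕ.⊔ L) i≥))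
               (ℕ.m⊔n≤o⇒m≤o M N (ℕ.m⊔n≤o⇒m≤o (M ℕ.⊔ N) (K ℕ.⊔ L) j≥)))
        (q i j (ℕ.m⊔n≤o⇒n≤o M N (ℕ.m⊔n≤o⇒m≤o (M ℕ.⊔ N) (K ℕ.⊔ L) i≥))
               (ℕ.m⊔n≤o⇒n≤o M N (ℕ.m⊔n≤o⇒m≤o (M ℕ.⊔ N) (K ℕ.⊔ L) j≥))))
    where
    scaled : ∃[ δ ] (0ℚ ℚ.< δ × (B ℚ.+ C) ℚ.* δ ≡ ε)
    scaled = scale {B ℚ.+ C} {ε} (0<+ 0<B 0<C) 0<ε
    δ = proj₁ scaled
    0<δ = proj₁ (proj₂ scaled)
    [B+C]δ≡ε = proj₂ (proj₂ scaled)
    M = proj₁ (cx δ 0<δ)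
    N = proj₁ (cy δ 0<δ)
    p = proj₂ (cx δ 0<δ)
    q = proj₂ (cy δ 0<δ)

  *-cauchy : ∀ {x y} → IsCauchy x → IsCauchy y → IsCauchy (λ i → x i ℚ.* y i)
  *-cauchy {x} {y} cx cy =
    let B , 0<B , K , x≤B = bounded {x} cx
        C , 0<C , L , y≤C = bounded {y} cy
    in *-cauchy-bounded {x} {y} {B} {C} {K} {L} cx cy 0<B 0<C x≤B y≤C

fromℚ : ℚ → ℝ
fromℚ q = mkℝ (λ _ → q) λ ε 0<ε →
  0 , λ _ _ _ _ → subst (ℚ._< ε) (sym (cong ∣_∣ (ℚ.+-inverseʳ q))) 0<ε

fromℤ : ℤ → ℝ
fromℤ z = fromℚ (z ℚ./ 1)

0ℝ 1ℝ : ℝ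
0ℝ = fromℚ 0ℚ
1ℝ = fromℚ 1ℚ

infixl 7 _*ℝ_
infixl 6 _+ℝ_ _-ℝ_

_+ℝ_ _*ℝ_ _-ℝ_ : ℝ → ℝ → ℝ

x +ℝ y = mkℝ (λ i → seq x i ℚ.+ seq y i) (+-cauchy {seq x} {seq y} (cauchy x) (cauchy y))

x *ℝ y = mkℝ (λ i → seq x i ℚ.* seq y i) (*-cauchy {seq x} {seq y} (cauchy x) (cauchy y))

x -ℝ y = x +ℝ mkℝ (λ i → ℚ.- seq y i) (neg-cauchy {seq y} (cauchy y))

IsCeiling : ℝ → ℤ → Set
IsCeiling x z = x ≤ℝ fromℤ z × fromℤ z <ℝ x +ℝ 1ℝ

ConvergesTo : (ℕ → ℚ) → ℝ → Set
ConvergesTo q L = ∀ ε → 0ℚ ℚ.< ε →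
  ∃[ N ] (∀ i → N ℕ.≤ i → (L -ℝ fromℚ ε <ℝ fromℚ (q i)) × (fromℚ (q i) <ℝ L +ℝ fromℚ ε))

------------------------------------------------------------------------
-- Boolean functions

BoolFun : ℕ → Set
BoolFun n = Vec Bool n → Bool

-- All k-tuples with entries drawn from a list.
tuples : ∀ {A : Set} → List A → (k : ℕ) → List (Vec A k)
tuples xs zero    = [] ∷ []
tuples xs (suc k) = cartesianProductWith _∷_ xs (tuples xs k)

inputs : (n : ℕ) → List (Vec Bool n)
inputs n = tuples (false ∷ true ∷ []) n

∈-inputs : ∀ {n} (x : Vec Bool n) → x ∈ inputs n
∈-inputs []      = here refl
∈-inputs (b ∷ x) = ∈-cartesianProductWith⁺ _∷_ (∈-bools b) (∈-inputs x)
  where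
  ∈-bools : ∀ b → b ∈ false ∷ true ∷ []
  ∈-bools false = here refl
  ∈-bools true  = there (here refl)

-- Boolean functions are identified when they agree on all inputs.
_≗?_ : ∀ {n} (f g : BoolFun n) → Dec (f ≗ g)
_≗?_ {n} f g = map′ (λ p x → All.lookup p (∈-inputs x)) (λ p → All.universal p (inputs n))
  (All.all? (λ x → f x Bool.≟ g x) (inputs n))

ite : ∀ {n} → BoolFun n → BoolFun n → BoolFun (suc n)
ite f g (b ∷ x) = if b then g x else f x

-- Lists each of the 2^(2^n) Boolean functions exactly once up to _≗_: a
-- function of n+1 variables is determined by its two restrictions.
functions : (n : ℕ) → List (BoolFun n)
functions zero    = (λ _ → false) ∷ (λ _ → true) ∷ []
functions (suc n) = cartesianProductWith ite (functions n) (functions n)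

Monotone : ∀ {k} → BoolFun k → Set
Monotone α = ∀ x y → Pointwise Bool._≤_ x y → α x Bool.≤ α y

Balanced : ∀ {k} → BoolFun k → Set
Balanced {k} α = 2 ℕ.* length (filter (λ x → α x Bool.≟ true) (inputs k)) ≡ 2 ℕ.^ k

Unbalanced : ∀ {k} → BoolFun k → Set
Unbalanced α = ¬ Balanced α

weight : ∀ {n} → Vec Bool n → ℕ
weight = Vec.count (Bool._≟ true)

threshold : ∀ {n} → ℕ → BoolFun n
threshold m x = does (m ℕ.≤? weight x)

projection : ∀ {n} → Fin n → BoolFun n
projection j x = Vec.lookup x j

------------------------------------------------------------------------
-- The characteristic polynomial

sumℝ : List ℝ → ℝ
sumℝ = foldr _+ℝ_ 0ℝ

-- Pr[(X₁,…,X_k) = x] for independent X_j with Pr[X_j = 1] = p.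
bernoulli : ∀ {k} → ℝ → Vec Bool k → ℝ
bernoulli p []      = 1ℝ
bernoulli p (b ∷ x) = (if b then p else 1ℝ -ℝ p) *ℝ bernoulli p x

-- Pr[α(X₁,…,X_k) = 1]
characteristic : ∀ {k} → BoolFun k → ℝ → ℝ
characteristic {k} α p =
  sumℝ (map (λ x → if α x then bernoulli p x else 0ℝ) (inputs k))

------------------------------------------------------------------------
-- Growth processes

sumℚ : List ℚ → ℚ
sumℚ = foldr ℚ._+_ 0ℚ

productℚ : ∀ {k} → Vec ℚ k → ℚ
productℚ = Vec.foldr′ ℚ._*_ 1ℚ

-- The function α(g₁,…,g_k).
compose : ∀ {k n} → BoolFun k → Vec (BoolFun n) k → BoolFun n
compose α gs x = α (Vec.map (λ g → g x) gs)

-- The n projections are pairwise distinct, so each has probability 1/n.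
uniformProjections : (n : ℕ) .{{_ : ℕ.NonZero n}} → BoolFun n → ℚ
uniformProjections n f =
  if does (any? (λ j → f ≗? projection j)) then + 1 ℚ./ n else 0ℚ

growth : ∀ {k n} → (BoolFun n → ℚ) → BoolFun k → ℕ → BoolFun n → ℚ
growth         μ α zero    f = μ f
growth {k} {n} μ α (suc i) f =
  sumℚ (map (λ gs → if does (compose α gs ≗? f)
                    then productℚ (Vec.map (growth μ α i) gs)
                    else 0ℚ)
            (tuples (functions n) k))

IsLimitingDistribution : ∀ {n} → (ℕ → BoolFun n → ℚ) → (BoolFun n → ℝ) → Set
IsLimitingDistribution πs π = ∀ f → ConvergesTo (λ i → πs i f) (π f)

ConcentratedOn : ∀ {n} → (BoolFun n → ℝ) → BoolFun n → Set
ConcentratedOn π f = π f ≃ℝ 1ℝ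

{-# OPTIONS --safe #-}
module Submission where

-- Write A for the characteristic polynomial of α; charℚ is A at rational
-- points, defined by conditioning on one variable at a time. For a fixed input
-- x, the probability that the random function of generation i takes the value
-- 1 at x is the i-th iterate of A at weight x / n (uniform-level,
-- growth-level), since the arguments of α are independent. The theorem is
-- therefore a statement about the dynamics of A on the grid of points w/n.
--
-- Dynamics. The Moore-Shannon inequality says that the odds ratio (A/(1-A)) /
-- (p/(1-p)) of a monotone connective is nondecreasing in p; charℚ-odds states
-- it without division. Consequently, if A(q) < q then A shrinks every s in
-- [0,q] by a fixed factor below 1 (charℚ-contraction), so all iterates
-- starting there tend to 0, at a rate independent of s (iterate-bound,
-- harmonic-decay). Moreover no fixed point lies in (0,q], and Lipschitz
-- continuity of A gives q < t with a definite gap (subcritical⇒below). If A(q)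
-- > q, the same applied to the dual connective shows that the iterates tend to
-- 1 and t < q.
--
-- Arithmetic. What remains is that A(q) = q is impossible for rational q in
-- (0,1), and this is where unbalancedness enters (no-rational-fixed-point).
-- Write q = a/N in lowest terms, c = N - a, and let hom f c a be the sum of
-- a^|x| c^(k-|x|) over the inputs x with f x true. The equation A(q) = q
-- becomes N · hom α c a = a N^k. Being neither constantly true nor constantly
-- false, α is false at weight 0 and true at weight k. If α is false on all
-- inputs of weight at most 1, then a² divides the left side (²∣-hom), hence a
-- divides N^k and a = 1. If α is true on some input of weight 1, then A(p) ≥
-- p, and equality inside (0,1) forces α to be balanced (atom-hom-≥,
-- atom-balanced). The same dichotomy for the dual connective gives c = 1 or
-- balance. So q = 1/2, and A(1/2) = 1/2 says again that α is balanced.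
--
-- Conclusion. Every grid point is thus strictly on one side of t, decidably.
-- The last grid point m/n below t gives the ceiling m + 1 of tn, and at each x
-- the probability of a value other than the threshold's tends to 0. There are
-- finitely many x, so a union bound shows that the probability of the
-- threshold function tends to 1 (concentration), and the probabilities of all
-- other functions tend to 0 (limit).

open import Defs
open import Data.Nat.Base using (ℕ; NonZero)
open import Data.Integer.Base using (+_)
open import Data.Product.Base using (∃-syntax; _×_)

open import Data.Bool.Base as Bool
  using (Bool; true; false; not; if_then_else_; _∧_; _xor_; f≤t; b≤b)
import Data.Bool.Properties as Bool
open import Data.Empty using (⊥-elim)
open import Data.Fin.Base using (Fin; zero; suc)
open import Data.Fin.Properties using (any?; suc-injective; 0≢1+n) renaming (_≟_ to _≟ᶠ_)
import Data.Integer.Base as ℤ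
import Data.Integer.Properties as ℤ
open import Data.List.Base
  using (List; []; _∷_; map; _++_; filter; length; cartesianProductWith)
import Data.List.Properties as List
open import Data.List.Relation.Unary.All as All using (All; []; _∷_)
open import Data.Maybe.Base using (Maybe; just; nothing)
open import Data.Nat.Base as ℕ using (zero; suc)
open import Data.Nat.Coprimality using (Coprime; coprime-divisor; recompute)
open import Data.Nat.Divisibility
  using (_∣_; ∣m∣n⇒∣m+n; ∣n⇒∣m*n; ∣m+n∣m⇒∣n; *-monoʳ-∣; *-cancelˡ-∣; ∣1⇒≡1; m∣m*n; _∣0)
import Data.Nat.Properties as ℕ
import Data.Nat.Tactic.RingSolver as ℕ-Ring
open import Data.Product.Base using (_,_; proj₁; proj₂)
open import Data.Rational.Base
  using (ℚ; mkℚ; 0ℚ; 1ℚ; ½; _+_; _*_; _-_; -_; _⊓_; _≤_; _<_; ∣_∣;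
         toℚᵘ; *<*; positive; nonNegative)
  renaming (_/_ to _/ℚ_)
import Data.Rational.Properties as ℚ
open import Data.Rational.Unnormalised.Base as ℚᵘ using (mkℚᵘ; *≡*)
import Data.Rational.Unnormalised.Properties as ℚᵘ
open import Data.Sum.Base using (_⊎_; inj₁; inj₂)
open import Data.Vec.Base as Vec using (Vec; []; _∷_)
import Data.Vec.Properties as Vec
open import Data.Vec.Relation.Binary.Pointwise.Inductive using (Pointwise; []; _∷_)
open import Function.Base using (_∘_)
open import Function.Bundles using (mk⇔)
open import Level using (0ℓ)
open import Relation.Binary.Definitions using (tri<; tri≈; tri>)
open import Relation.Binary.PropositionalEquality
open import Relation.Nullary using (¬_; Dec; yes; no; does; _×-dec_)
open import Relation.Nullary.Decidable using (does-⇔; dec-true; dec-false)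
open import Relation.Unary using (Decidable)
open import Tactic.RingSolver using (solve-∀)
import Tactic.RingSolver.Core.AlmostCommutativeRing as ACR

-- Inequalities between rationals

ringℚ : ACR.AlmostCommutativeRing 0ℓ 0ℓ
ringℚ = ACR.fromCommutativeRing ℚ.+-*-commutativeRing isZero
  where
  isZero : ∀ q → Maybe (0ℚ ≡ q)
  isZero q with 0ℚ ℚ.≟ q
  ... | yes e = just e
  ... | no _  = nothing

0≤1 : 0ℚ ≤ 1ℚ
0≤1 = ℚ.nonNegative⁻¹ 1ℚ

0<1 : 0ℚ < 1ℚ
0<1 = ℚ.positive⁻¹ 1ℚ

0≤+ : ∀ {a b} → 0ℚ ≤ a → 0ℚ ≤ b → 0ℚ ≤ a + b
0≤+ = ℚ.+-mono-≤

0≤* : ∀ {a b} → 0ℚ ≤ a → 0ℚ ≤ b → 0ℚ ≤ a * b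
0≤* {a} {b} 0≤a 0≤b =
  ℚ.nonNegative⁻¹ (a * b)
    {{ℚ.nonNeg*nonNeg⇒nonNeg a {{nonNegative 0≤a}} b {{nonNegative 0≤b}}}}

0<* : ∀ {a b} → 0ℚ < a → 0ℚ < b → 0ℚ < a * b
0<* {a} {b} 0<a 0<b =
  ℚ.positive⁻¹ (a * b) {{ℚ.pos*pos⇒pos a {{positive 0<a}} b {{positive 0<b}}}}

*-monoˡ : ∀ {a b c} → 0ℚ ≤ c → a ≤ b → c * a ≤ c * b
*-monoˡ {c = c} 0≤c = ℚ.*-monoˡ-≤-nonNeg c {{nonNegative 0≤c}}

*-monoʳ : ∀ {a b c} → 0ℚ ≤ c → a ≤ b → a * c ≤ b * c
*-monoʳ {c = c} 0≤c = ℚ.*-monoʳ-≤-nonNeg c {{nonNegative 0≤c}}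

-- Most inequalities below are proved by exhibiting the larger side as the
-- smaller side plus an expression that is visibly nonnegative; the equation is
-- then a ring identity.
≤-excess : ∀ {a b} e → 0ℚ ≤ e → b ≡ a + e → a ≤ b
≤-excess {a} e 0≤e refl = subst (_≤ a + e) (ℚ.+-identityʳ a) (ℚ.+-monoʳ-≤ a 0≤e)

<-excess : ∀ {a b} e → 0ℚ < e → b ≡ a + e → a < b
<-excess {a} e 0<e refl = subst (_< a + e) (ℚ.+-identityʳ a) (ℚ.+-monoʳ-< a 0<e)

≤⇒0≤- : ∀ {a b} → a ≤ b → 0ℚ ≤ b - a
≤⇒0≤- {a} {b} a≤b = subst (_≤ b - a) (ℚ.+-inverseʳ a) (ℚ.+-monoˡ-≤ (- a) a≤b)

<⇒0<- : ∀ {a b} → a < b → 0ℚ < b - a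
<⇒0<- {a} {b} a<b = subst (_< b - a) (ℚ.+-inverseʳ a) (ℚ.+-monoˡ-< (- a) a<b)

0≤-⇒≤ : ∀ {a b} → 0ℚ ≤ b - a → a ≤ b
0≤-⇒≤ {a} {b} h = ≤-excess (b - a) h (lem a b)
  where
  lem : ∀ a b → b ≡ a + (b - a)
  lem = solve-∀ ringℚ

0<-⇒< : ∀ {a b} → 0ℚ < b - a → a < b
0<-⇒< {a} {b} h = <-excess (b - a) h (lem a b)
  where
  lem : ∀ a b → b ≡ a + (b - a)
  lem = solve-∀ ringℚ

-- The embedding of ℕ, by recursion so that it meets the ring identities directly.
fromℕ : ℕ → ℚ
fromℕ zero    = 0ℚ
fromℕ (suc n) = 1ℚ + fromℕ n

0≤fromℕ : ∀ n → 0ℚ ≤ fromℕ n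
0≤fromℕ zero    = ℚ.≤-refl
0≤fromℕ (suc n) = 0≤+ 0≤1 (0≤fromℕ n)

-- The closed unit interval.
𝕀 : ℚ → Set
𝕀 p = 0ℚ ≤ p × p ≤ 1ℚ

1-𝕀 : ∀ {p} → 𝕀 p → 𝕀 (1ℚ - p)
1-𝕀 {p} (0≤p , p≤1) = ≤⇒0≤- p≤1 , ≤-excess p 0≤p (lem p)
  where
  lem : ∀ p → 1ℚ ≡ (1ℚ - p) + p
  lem = solve-∀ ringℚ

-- The characteristic polynomial at rational points

-- The function of the remaining variables obtained by fixing the first to b.
restrict : ∀ {k} → Bool → BoolFun (suc k) → BoolFun k
restrict b f x = f (b ∷ x)

-- The characteristic polynomial: Pr[f(X₁,…,X_k) = 1] when each X_j is 1 with
-- probability p, computed by conditioning on X₁.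
charℚ : ∀ {k} → BoolFun k → ℚ → ℚ
charℚ {zero}  f p = if f [] then 1ℚ else 0ℚ
charℚ {suc k} f p = (1ℚ - p) * charℚ (restrict false f) p + p * charℚ (restrict true f) p

Pointwise-refl : ∀ {k} (x : Vec Bool k) → Pointwise Bool._≤_ x x
Pointwise-refl []      = []
Pointwise-refl (b ∷ x) = b≤b ∷ Pointwise-refl x

restrict-monotone : ∀ {k} {f : BoolFun (suc k)} b → Monotone f → Monotone (restrict b f)
restrict-monotone b mono x y x≤y = mono (b ∷ x) (b ∷ y) (b≤b ∷ x≤y)

restrict-≤ : ∀ {k} {f : BoolFun (suc k)} → Monotone f →
  ∀ x → restrict false f x Bool.≤ restrict true f x
restrict-≤ mono x = mono (false ∷ x) (true ∷ x) (f≤t ∷ Pointwise-refl x)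

charℚ-𝕀 : ∀ {k} (f : BoolFun k) {p} → 𝕀 p → 𝕀 (charℚ f p)
charℚ-𝕀 {zero} f _ with f []
... | true  = 0≤1 , ℚ.≤-refl
... | false = ℚ.≤-refl , 0≤1
charℚ-𝕀 {suc k} f {p} p∈𝕀 =
  let F∈ = charℚ-𝕀 (restrict false f) p∈𝕀
      G∈ = charℚ-𝕀 (restrict true f) p∈𝕀
      0≤1-p = proj₁ (1-𝕀 p∈𝕀)
      0≤p = proj₁ p∈𝕀
  in 0≤+ (0≤* 0≤1-p (proj₁ F∈)) (0≤* 0≤p (proj₁ G∈))
   , ≤-excess _ (0≤+ (0≤* 0≤1-p (proj₁ (1-𝕀 F∈))) (0≤* 0≤p (proj₁ (1-𝕀 G∈))))
       (lem p (charℚ (restrict false f) p) (charℚ (restrict true f) p))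
  where
  lem : ∀ p F G → 1ℚ ≡ ((1ℚ - p) * F + p * G) + ((1ℚ - p) * (1ℚ - F) + p * (1ℚ - G))
  lem = solve-∀ ringℚ

charℚ-mono : ∀ {k} (f g : BoolFun k) {p} → 𝕀 p →
  (∀ x → f x Bool.≤ g x) → charℚ f p ≤ charℚ g p
charℚ-mono {zero} f g _ f≤g with f [] | g [] | f≤g []
... | false | true  | f≤t = 0≤1
... | _     | _     | b≤b = ℚ.≤-refl
charℚ-mono {suc k} f g p∈𝕀 f≤g = ℚ.+-mono-≤
  (*-monoˡ (proj₁ (1-𝕀 p∈𝕀)) (charℚ-mono (restrict false f) (restrict false g) p∈𝕀 (λ x → f≤g (false ∷ x))))
  (*-monoˡ (proj₁ p∈𝕀) (charℚ-mono (restrict true f) (restrict true g) p∈𝕀 (λ x → f≤g (true ∷ x))))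

charℚ-true : ∀ {k} (f : BoolFun k) p → (∀ x → f x ≡ true) → charℚ f p ≡ 1ℚ
charℚ-true {zero}  f p all rewrite all [] = refl
charℚ-true {suc k} f p all
  rewrite charℚ-true (restrict false f) p (λ x → all (false ∷ x))
        | charℚ-true (restrict true f) p (λ x → all (true ∷ x)) = lem p
  where
  lem : ∀ p → (1ℚ - p) * 1ℚ + p * 1ℚ ≡ 1ℚ
  lem = solve-∀ ringℚ

charℚ-Lipschitz : ∀ {k} (f : BoolFun k) {p q} → 𝕀 p → p ≤ q → 𝕀 q →
  charℚ f q ≤ charℚ f p + fromℕ k * (q - p)
charℚ-Lipschitz {zero} f {p} {q} _ _ _ = ≤-excess 0ℚ ℚ.≤-refl (lem (charℚ f q) (q - p))
  where
  lem : ∀ A d → A + 0ℚ * d ≡ A + 0ℚ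
  lem = solve-∀ ringℚ
charℚ-Lipschitz {suc k} f {p} {q} p∈𝕀 p≤q q∈𝕀 =
  let F  = charℚ (restrict false f) p
      G  = charℚ (restrict true f) p
      F′ = charℚ (restrict false f) q
      G′ = charℚ (restrict true f) q
      c  = fromℕ k
      hF = ≤⇒0≤- (charℚ-Lipschitz (restrict false f) p∈𝕀 p≤q q∈𝕀)
      hG = ≤⇒0≤- (charℚ-Lipschitz (restrict true f) p∈𝕀 p≤q q∈𝕀)
      0≤F = proj₁ (charℚ-𝕀 (restrict false f) p∈𝕀)
      0≤1-G = proj₁ (1-𝕀 (charℚ-𝕀 (restrict true f) p∈𝕀))
  in ≤-excess ((1ℚ - q) * (F + c * (q - p) - F′) + q * (G + c * (q - p) - G′)
                + (q - p) * (F + (1ℚ - G)))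
       (0≤+ (0≤+ (0≤* (proj₁ (1-𝕀 q∈𝕀)) hF) (0≤* (proj₁ q∈𝕀) hG))
            (0≤* (≤⇒0≤- p≤q) (0≤+ 0≤F 0≤1-G)))
       (lem p q F G F′ G′ c)
  where
  lem : ∀ p q F G F′ G′ c →
    ((1ℚ - p) * F + p * G) + (1ℚ + c) * (q - p)
      ≡ ((1ℚ - q) * F′ + q * G′)
        + ((1ℚ - q) * (F + c * (q - p) - F′) + q * (G + c * (q - p) - G′)
            + (q - p) * (F + (1ℚ - G)))
  lem = solve-∀ ringℚ

-- The Moore-Shannon inequality. With u = (1-p)q, v = p(1-q), F = A(p) and
-- F′ = A(q), comparing the odds, (F/(1-F))/(p/(1-p)) ≤ (F′/(1-F′))/(q/(1-q))
-- clears to u F (1-F′) ≤ v F′ (1-F), which is u F ≤ (v(1-F) + u F) F′.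
charℚ-odds : ∀ {k} (f : BoolFun k) → Monotone f → ∀ {p q} → 𝕀 p → p ≤ q → 𝕀 q →
  ((1ℚ - p) * q) * charℚ f p
    ≤ ((p * (1ℚ - q)) * (1ℚ - charℚ f p) + ((1ℚ - p) * q) * charℚ f p) * charℚ f q
charℚ-odds {zero} f _ {p} {q} _ _ _ with f []
... | true  = ≤-excess 0ℚ ℚ.≤-refl (lem p q)
  where
  lem : ∀ p q → ((p * (1ℚ - q)) * (1ℚ - 1ℚ) + ((1ℚ - p) * q) * 1ℚ) * 1ℚ ≡ ((1ℚ - p) * q) * 1ℚ + 0ℚ
  lem = solve-∀ ringℚ
... | false = ≤-excess 0ℚ ℚ.≤-refl (lem p q)
  where
  lem : ∀ p q → ((p * (1ℚ - q)) * (1ℚ - 0ℚ) + ((1ℚ - p) * q) * 0ℚ) * 0ℚ ≡ ((1ℚ - p) * q) * 0ℚ + 0ℚ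
  lem = solve-∀ ringℚ
charℚ-odds {suc k} f mono {p} {q} p∈𝕀 p≤q q∈𝕀 =
  ≤-excess _
    (0≤+ (0≤+ (0≤* (0≤+ (0≤* 0≤1-p 0≤1-q) (0≤* 0≤1-p 0≤q)) hF)
              (0≤* (0≤+ (0≤* 0≤p 0≤q) (0≤* 0≤p 0≤1-q)) hG))
         (0≤* (0≤* (≤⇒0≤- p≤q)
                   (0≤+ (0≤* (0≤* 0≤p 0≤1-q) 0≤1-G) (0≤* (0≤* 0≤1-p 0≤q) 0≤F)))
              F′≤G′))
    (lem p q (charℚ (restrict false f) p) (charℚ (restrict true f) p)
             (charℚ (restrict false f) q) (charℚ (restrict true f) q))
  where
  0≤p = proj₁ p∈𝕀
  0≤q = proj₁ q∈𝕀
  0≤1-p = proj₁ (1-𝕀 p∈𝕀)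
  0≤1-q = proj₁ (1-𝕀 q∈𝕀)
  hF = ≤⇒0≤- (charℚ-odds (restrict false f) (restrict-monotone {f = f} false mono) p∈𝕀 p≤q q∈𝕀)
  hG = ≤⇒0≤- (charℚ-odds (restrict true f) (restrict-monotone {f = f} true mono) p∈𝕀 p≤q q∈𝕀)
  0≤F = proj₁ (charℚ-𝕀 (restrict false f) p∈𝕀)
  0≤1-G = proj₁ (1-𝕀 (charℚ-𝕀 (restrict true f) p∈𝕀))
  F′≤G′ = ≤⇒0≤- (charℚ-mono (restrict false f) (restrict true f) q∈𝕀 (restrict-≤ {f = f} mono))
  -- Besides nonnegative multiples of the two inductive inequalities there remains
  -- (u-v)(v(1-G) + uF)(G′-F′), with u - v = q - p; it is nonnegative because
  -- F′ ≤ G′, which is where monotonicity is used.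
  lem : ∀ p q F G F′ G′ →
    ((p * (1ℚ - q)) * (1ℚ - ((1ℚ - p) * F + p * G)) + ((1ℚ - p) * q) * ((1ℚ - p) * F + p * G))
      * ((1ℚ - q) * F′ + q * G′)
    ≡ ((1ℚ - p) * q) * ((1ℚ - p) * F + p * G)
      + (((1ℚ - p) * (1ℚ - q) + (1ℚ - p) * q)
           * (((p * (1ℚ - q)) * (1ℚ - F) + ((1ℚ - p) * q) * F) * F′ - ((1ℚ - p) * q) * F)
         + (p * q + p * (1ℚ - q))
           * (((p * (1ℚ - q)) * (1ℚ - G) + ((1ℚ - p) * q) * G) * G′ - ((1ℚ - p) * q) * G)
         + (q - p) * ((p * (1ℚ - q)) * (1ℚ - G) + ((1ℚ - p) * q) * F) * (G′ - F′))
  lem = solve-∀ ringℚ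

-- If A(q) < q, then A multiplies every s in [0,q] by at most
-- 1 - (q - A(q))(1 - q) < 1.
charℚ-contraction : ∀ {k} (f : BoolFun k) → Monotone f → ∀ {s q} → 𝕀 s → s ≤ q → 𝕀 q →
  charℚ f q < q → charℚ f s + (q - charℚ f q) * (1ℚ - q) * s ≤ s
charℚ-contraction f mono {s} {q} s∈𝕀 s≤q q∈𝕀 b<q =
  ≤-excess _
    (0≤+ (0≤+ (0≤* 0≤1-B 0≤s-y) odds) (0≤* (0≤* 0≤d 0≤s) (0≤+ (≤⇒0≤- s≤q) 0≤s-y)))
    (lem₂ s q y b)
  where
  y = charℚ f s
  b = charℚ f q
  0≤s = proj₁ s∈𝕀
  y∈𝕀 = charℚ-𝕀 f s∈𝕀
  b∈𝕀 = charℚ-𝕀 f q∈𝕀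
  d = q - b
  B = (1ℚ - b) * q
  0≤d : 0ℚ ≤ d
  0≤d = ≤⇒0≤- (ℚ.<⇒≤ b<q)
  lem₁ : ∀ s q y b →
    ((s * (1ℚ - q)) * (1ℚ - y) + ((1ℚ - s) * q) * y) * b - ((1ℚ - s) * q) * y
      ≡ ((1ℚ - b) * q) * (s - y) - (q - b) * s * (1ℚ - y)
  lem₁ = solve-∀ ringℚ
  -- The Moore-Shannon inequality for s ≤ q, rearranged.
  odds : 0ℚ ≤ B * (s - y) - d * s * (1ℚ - y)
  odds = subst (0ℚ ≤_) (lem₁ s q y b) (≤⇒0≤- (charℚ-odds f mono s∈𝕀 s≤q q∈𝕀))
  lem₃ : ∀ b q → (1ℚ - b) * q ≡ (q - b) + b * (1ℚ - q)
  lem₃ = solve-∀ ringℚ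
  0<B : 0ℚ < B
  0<B = ℚ.<-≤-trans (<⇒0<- b<q)
    (≤-excess (b * (1ℚ - q)) (0≤* (proj₁ b∈𝕀) (proj₁ (1-𝕀 q∈𝕀))) (lem₃ b q))
  lem₄ : ∀ b q → 1ℚ - (1ℚ - b) * q ≡ (1ℚ - q) + b * q
  lem₄ = solve-∀ ringℚ
  0≤1-B : 0ℚ ≤ 1ℚ - B
  0≤1-B = subst (0ℚ ≤_) (sym (lem₄ b q))
    (0≤+ (proj₁ (1-𝕀 q∈𝕀)) (0≤* (proj₁ b∈𝕀) (proj₁ q∈𝕀)))
  0≤s-y : 0ℚ ≤ s - y
  0≤s-y = ℚ.*-cancelˡ-≤-pos B {{positive 0<B}}
    (subst (_≤ B * (s - y)) (sym (ℚ.*-zeroʳ B))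
      (ℚ.≤-trans (0≤* (0≤* 0≤d 0≤s) (proj₁ (1-𝕀 y∈𝕀))) (0≤-⇒≤ odds)))
  lem₂ : ∀ s q y b → s ≡ (y + (q - b) * (1ℚ - q) * s)
    + ((1ℚ - (1ℚ - b) * q) * (s - y) + (((1ℚ - b) * q) * (s - y) - (q - b) * s * (1ℚ - y))
       + (q - b) * s * ((q - s) + (s - y)))
  lem₂ = solve-∀ ringℚ

-- Duality

-- The De Morgan dual.
dual : ∀ {k} → BoolFun k → BoolFun k
dual f x = not (f (Vec.map not x))

dual-monotone : ∀ {k} {f : BoolFun k} → Monotone f → Monotone (dual f)
dual-monotone {f = f} mono x y x≤y = not-anti (mono _ _ (map-anti x≤y))
  where
  not-anti : ∀ {a b} → a Bool.≤ b → not b Bool.≤ not a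
  not-anti f≤t = f≤t
  not-anti b≤b = b≤b
  map-anti : ∀ {k} {x y : Vec Bool k} → Pointwise Bool._≤_ x y →
    Pointwise Bool._≤_ (Vec.map not y) (Vec.map not x)
  map-anti []          = []
  map-anti (a≤b ∷ x≤y) = not-anti a≤b ∷ map-anti x≤y

charℚ-dual : ∀ {k} (f : BoolFun k) p → charℚ (dual f) (1ℚ - p) ≡ 1ℚ - charℚ f p
charℚ-dual {zero} f p with f []
... | true  = refl
... | false = refl
charℚ-dual {suc k} f p
  rewrite charℚ-dual (restrict true f) p | charℚ-dual (restrict false f) p
  = lem p (charℚ (restrict false f) p) (charℚ (restrict true f) p)
  where
  lem : ∀ p F G → (1ℚ - (1ℚ - p)) * (1ℚ - G) + (1ℚ - p) * (1ℚ - F)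
                ≡ 1ℚ - ((1ℚ - p) * F + p * G)
  lem = solve-∀ ringℚ

-- Rational fixed points

zeros : ∀ k → Vec Bool k
zeros k = Vec.replicate k false

zeros-least : ∀ {k} (x : Vec Bool k) → Pointwise Bool._≤_ (zeros k) x
zeros-least []          = []
zeros-least (false ∷ x) = b≤b ∷ zeros-least x
zeros-least (true ∷ x)  = f≤t ∷ zeros-least x

≤-true : ∀ {a b} → a Bool.≤ b → a ≡ true → b ≡ true
≤-true b≤b a≡t = a≡t

monotone-true : ∀ {k} (f : BoolFun k) → Monotone f → f (zeros k) ≡ true → ∀ x → f x ≡ true
monotone-true f mono f0 x = ≤-true (mono _ _ (zeros-least x)) f0

-- The sum of a^|x| c^(k-|x|) over the inputs x with f x true: the homogeneous
-- form of the characteristic polynomial, equal to (c + a)^k A(a/(c + a)).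
hom : ∀ {k} → BoolFun k → ℕ → ℕ → ℕ
hom {zero}  f c a = if f [] then 1 else 0
hom {suc k} f c a = c ℕ.* hom (restrict false f) c a ℕ.+ a ℕ.* hom (restrict true f) c a

-- The number of inputs on which f is true; f is balanced when twice this is 2^k.
trues : ∀ {k} → BoolFun k → ℕ
trues f = hom f 1 1

hom-true : ∀ {k} (f : BoolFun k) c a → (∀ x → f x ≡ true) → hom f c a ≡ (c ℕ.+ a) ℕ.^ k
hom-true {zero}  f c a all rewrite all [] = refl
hom-true {suc k} f c a all
  rewrite hom-true (restrict false f) c a (λ x → all (false ∷ x))
        | hom-true (restrict true f) c a (λ x → all (true ∷ x))
  = sym (ℕ.*-distribʳ-+ ((c ℕ.+ a) ℕ.^ k) c a)

hom-dual : ∀ {k} (f : BoolFun k) c a → hom (dual f) a c ℕ.+ hom f c a ≡ (c ℕ.+ a) ℕ.^ k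
hom-dual {zero} f c a with f []
... | true  = refl
... | false = refl
hom-dual {suc k} f c a = begin
  (a ℕ.* G* ℕ.+ c ℕ.* F*) ℕ.+ (c ℕ.* F ℕ.+ a ℕ.* G)
    ≡⟨ lem a c F G F* G* ⟩
  c ℕ.* (F* ℕ.+ F) ℕ.+ a ℕ.* (G* ℕ.+ G)
    ≡⟨ cong₂ (λ u v → c ℕ.* u ℕ.+ a ℕ.* v)
         (hom-dual (restrict false f) c a) (hom-dual (restrict true f) c a) ⟩
  c ℕ.* (c ℕ.+ a) ℕ.^ k ℕ.+ a ℕ.* (c ℕ.+ a) ℕ.^ k
    ≡⟨ ℕ.*-distribʳ-+ ((c ℕ.+ a) ℕ.^ k) c a ⟨
  (c ℕ.+ a) ℕ.* (c ℕ.+ a) ℕ.^ k ∎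
  where
  open ≡-Reasoning
  F  = hom (restrict false f) c a
  G  = hom (restrict true f) c a
  F* = hom (dual (restrict false f)) a c
  G* = hom (dual (restrict true f)) a c
  lem : ∀ a c F G F* G* → (a ℕ.* G* ℕ.+ c ℕ.* F*) ℕ.+ (c ℕ.* F ℕ.+ a ℕ.* G)
                        ≡ c ℕ.* (F* ℕ.+ F) ℕ.+ a ℕ.* (G* ℕ.+ G)
  lem = ℕ-Ring.solve-∀

-- An input of weight one on which f is true.
data Atom : ∀ {k} → BoolFun k → Set where
  head : ∀ {k} {f : BoolFun (suc k)} → f (true ∷ zeros k) ≡ true → Atom f
  tail : ∀ {k} {f : BoolFun (suc k)} → Atom (restrict false f) → Atom f

atom? : ∀ {k} (f : BoolFun k) → Dec (Atom f)
atom? {zero}  f = no λ ()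
atom? {suc k} f with f (true ∷ zeros k) Bool.≟ true | atom? (restrict false f)
... | yes p | _     = yes (head p)
... | no _  | yes p = yes (tail p)
... | no ¬p | no ¬q = no λ { (head p) → ¬p p ; (tail q) → ¬q q }

≢true⇒≡false : ∀ {b} → ¬ (b ≡ true) → b ≡ false
≢true⇒≡false {false} _ = refl
≢true⇒≡false {true}  h = ⊥-elim (h refl)

∣-hom : ∀ {k} (f : BoolFun k) c a → f (zeros k) ≡ false → a ∣ hom f c a
∣-hom {zero}  f c a f0 rewrite f0 = a ∣0
∣-hom {suc k} f c a f0 = ∣m∣n⇒∣m+n
  (∣n⇒∣m*n c (∣-hom (restrict false f) c a f0)) (m∣m*n (hom (restrict true f) c a))

²∣-hom : ∀ {k} (f : BoolFun k) c a → f (zeros k) ≡ false → ¬ Atom f → a ℕ.* a ∣ hom f c a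
²∣-hom {zero}  f c a f0 _ rewrite f0 = (a ℕ.* a) ∣0
²∣-hom {suc k} f c a f0 ¬atom = ∣m∣n⇒∣m+n
  (∣n⇒∣m*n c (²∣-hom (restrict false f) c a f0 (λ h → ¬atom (tail h))))
  (*-monoʳ-∣ a (∣-hom (restrict true f) c a (≢true⇒≡false (λ h → ¬atom (head h)))))

-- A sum with positive weights vanishes only if it is empty.
hom≡0⇒trues≡0 : ∀ {k} (f : BoolFun k) c a .{{_ : NonZero c}} .{{_ : NonZero a}} →
  hom f c a ≡ 0 → trues f ≡ 0
hom≡0⇒trues≡0 {zero}  f c a h = h
hom≡0⇒trues≡0 {suc k} f c a h
  rewrite hom≡0⇒trues≡0 (restrict false f) c a
            (ℕ.m*n≡0⇒m≡0 _ c (trans (ℕ.*-comm _ c) (ℕ.m+n≡0⇒m≡0 _ h)))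
        | hom≡0⇒trues≡0 (restrict true f) c a
            (ℕ.m*n≡0⇒m≡0 _ a (trans (ℕ.*-comm _ a)
              (ℕ.m+n≡0⇒n≡0 (c ℕ.* hom (restrict false f) c a) h)))
  = refl

atom-true : ∀ {k} {f : BoolFun (suc k)} → Monotone f → f (true ∷ zeros k) ≡ true →
  ∀ x → restrict true f x ≡ true
atom-true {f = f} mono h =
  monotone-true (restrict true f) (restrict-monotone {f = f} true mono) h

atom-mono : ∀ {k} {f g : BoolFun k} → (∀ x → f x Bool.≤ g x) → Atom f → Atom g
atom-mono f≤g (head h) = head (≤-true (f≤g _) h)
atom-mono f≤g (tail h) = tail (atom-mono (λ x → f≤g (false ∷ x)) h)

-- That is, A(p) ≥ p at p = a/(c + a): such an f lies above a projection.
atom-hom-≥ : ∀ {k} (f : BoolFun k) c a → Monotone f → Atom f →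
  a ℕ.* (c ℕ.+ a) ℕ.^ k ℕ.≤ (c ℕ.+ a) ℕ.* hom f c a
atom-hom-≥ {suc k} f c a mono (head h)
  rewrite hom-true (restrict true f) c a (atom-true {f = f} mono h)
  = subst (a ℕ.* (N ℕ.* M) ℕ.≤_) (sym (lem N c a M (hom (restrict false f) c a)))
      (ℕ.m≤n+m _ _)
  where
  N = c ℕ.+ a
  M = N ℕ.^ k
  lem : ∀ N c a M Z → N ℕ.* (c ℕ.* Z ℕ.+ a ℕ.* M) ≡ N ℕ.* (c ℕ.* Z) ℕ.+ a ℕ.* (N ℕ.* M)
  lem = ℕ-Ring.solve-∀
atom-hom-≥ {suc k} f c a mono (tail h) = begin
  a ℕ.* ((c ℕ.+ a) ℕ.* M)                ≡⟨ lem₁ a c M ⟩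
  c ℕ.* (a ℕ.* M) ℕ.+ a ℕ.* (a ℕ.* M)    ≤⟨ ℕ.+-mono-≤
    (ℕ.*-monoʳ-≤ c (atom-hom-≥ (restrict false f) c a (restrict-monotone {f = f} false mono) h))
    (ℕ.*-monoʳ-≤ a (atom-hom-≥ (restrict true f) c a (restrict-monotone {f = f} true mono)
      (atom-mono (restrict-≤ {f = f} mono) h))) ⟩
  c ℕ.* (N ℕ.* F) ℕ.+ a ℕ.* (N ℕ.* G)    ≡⟨ lem₂ N c a F G ⟩
  N ℕ.* (c ℕ.* F ℕ.+ a ℕ.* G) ∎
  where
  open ℕ.≤-Reasoning
  N = c ℕ.+ a
  M = N ℕ.^ k
  F = hom (restrict false f) c a
  G = hom (restrict true f) c a
  lem₁ : ∀ a c M → a ℕ.* ((c ℕ.+ a) ℕ.* M) ≡ c ℕ.* (a ℕ.* M) ℕ.+ a ℕ.* (a ℕ.* M)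
  lem₁ = ℕ-Ring.solve-∀
  lem₂ : ∀ N c a F G → c ℕ.* (N ℕ.* F) ℕ.+ a ℕ.* (N ℕ.* G) ≡ N ℕ.* (c ℕ.* F ℕ.+ a ℕ.* G)
  lem₂ = ℕ-Ring.solve-∀

-- A positively weighted mean of two numbers, both at least m, equals m only if
-- both do.
mix-≡ : ∀ {c a m x y} .{{_ : NonZero c}} → m ℕ.≤ x → m ℕ.≤ y →
  c ℕ.* x ℕ.+ a ℕ.* y ≡ c ℕ.* m ℕ.+ a ℕ.* m → x ≡ m
mix-≡ {c} {a} {m} {x} {y} m≤x m≤y eq = ℕ.≤-antisym
  (ℕ.*-cancelˡ-≤ c (ℕ.+-cancelʳ-≤ (a ℕ.* m) (c ℕ.* x) (c ℕ.* m)
    (ℕ.≤-trans (ℕ.+-monoʳ-≤ (c ℕ.* x) (ℕ.*-monoʳ-≤ a m≤y)) (ℕ.≤-reflexive eq))))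
  m≤x

-- If moreover A(p) = p at p = a/(c + a), then f can only be that projection, and
-- projections are balanced.
atom-balanced : ∀ {k} (f : BoolFun k) c a .{{_ : NonZero c}} .{{_ : NonZero a}} →
  Monotone f → Atom f → (c ℕ.+ a) ℕ.* hom f c a ≡ a ℕ.* (c ℕ.+ a) ℕ.^ k →
  2 ℕ.* trues f ≡ 2 ℕ.^ k
atom-balanced {suc k} f c a mono (head h) eq = trans
  (cong₂ (λ x y → 2 ℕ.* (1 ℕ.* x ℕ.+ 1 ℕ.* y))
    (hom≡0⇒trues≡0 (restrict false f) c a Z≡0)
    (hom-true (restrict true f) 1 1 all-true))
  (lem₂ (2 ℕ.^ k))
  where
  all-true = atom-true {f = f} mono h
  N = c ℕ.+ a
  M = N ℕ.^ k
  Z = hom (restrict false f) c a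
  eq′ : N ℕ.* (c ℕ.* Z ℕ.+ a ℕ.* M) ≡ a ℕ.* (N ℕ.* M)
  eq′ = trans (cong (λ G → N ℕ.* (c ℕ.* Z ℕ.+ a ℕ.* G)) 
    (sym (hom-true (restrict true f) c a all-true))) eq
  lem : ∀ N c a M Z → N ℕ.* (c ℕ.* Z ℕ.+ a ℕ.* M) ≡ (N ℕ.* c) ℕ.* Z ℕ.+ a ℕ.* (N ℕ.* M)
  lem = ℕ-Ring.solve-∀
  instance
    N≢0 : NonZero N
    N≢0 = ℕ.>-nonZero (ℕ.≤-trans (ℕ.>-nonZero⁻¹ c) (ℕ.m≤m+n c a))
    Nc≢0 : NonZero (N ℕ.* c)
    Nc≢0 = ℕ.m*n≢0 N c
  Z≡0 : Z ≡ 0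
  Z≡0 = ℕ.m*n≡0⇒m≡0 Z (N ℕ.* c) (trans (ℕ.*-comm Z (N ℕ.* c))
    (ℕ.+-cancelʳ-≡ (a ℕ.* (N ℕ.* M)) ((N ℕ.* c) ℕ.* Z) 0 (trans (sym (lem N c a M Z)) eq′)))
  lem₂ : ∀ M → 2 ℕ.* (1 ℕ.* 0 ℕ.+ 1 ℕ.* M) ≡ 2 ℕ.* M
  lem₂ = ℕ-Ring.solve-∀
atom-balanced {suc k} f c a mono (tail h) eq = begin
  2 ℕ.* (1 ℕ.* trues (restrict false f) ℕ.+ 1 ℕ.* trues (restrict true f))
    ≡⟨ lem₃ (trues (restrict false f)) (trues (restrict true f)) ⟩
  2 ℕ.* trues (restrict false f) ℕ.+ 2 ℕ.* trues (restrict true f)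
    ≡⟨ cong₂ ℕ._+_
         (atom-balanced (restrict false f) c a monoF h (mix-≡ {c} {a} ≥F ≥G eq′))
         (atom-balanced (restrict true f) c a monoG h′
           (mix-≡ {a} {c} ≥G ≥F (trans (ℕ.+-comm (a ℕ.* _) _) (trans eq′ (ℕ.+-comm (c ℕ.* _) _))))) ⟩
  2 ℕ.^ k ℕ.+ 2 ℕ.^ k
    ≡⟨ cong (2 ℕ.^ k ℕ.+_) (ℕ.+-identityʳ (2 ℕ.^ k)) ⟨
  2 ℕ.* 2 ℕ.^ k ∎
  where
  open ≡-Reasoning
  N = c ℕ.+ a
  M = N ℕ.^ k
  F = hom (restrict false f) c a
  G = hom (restrict true f) c a
  monoF = restrict-monotone {f = f} false mono
  monoG = restrict-monotone {f = f} true mono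
  h′ = atom-mono (restrict-≤ {f = f} mono) h
  ≥F = atom-hom-≥ (restrict false f) c a monoF h
  ≥G = atom-hom-≥ (restrict true f) c a monoG h′
  lem₁ : ∀ a c M → a ℕ.* ((c ℕ.+ a) ℕ.* M) ≡ c ℕ.* (a ℕ.* M) ℕ.+ a ℕ.* (a ℕ.* M)
  lem₁ = ℕ-Ring.solve-∀
  lem₂ : ∀ N c a F G → c ℕ.* (N ℕ.* F) ℕ.+ a ℕ.* (N ℕ.* G) ≡ N ℕ.* (c ℕ.* F ℕ.+ a ℕ.* G)
  lem₂ = ℕ-Ring.solve-∀
  lem₃ : ∀ x y → 2 ℕ.* (1 ℕ.* x ℕ.+ 1 ℕ.* y) ≡ 2 ℕ.* x ℕ.+ 2 ℕ.* y
  lem₃ = ℕ-Ring.solve-∀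
  eq′ : c ℕ.* (N ℕ.* F) ℕ.+ a ℕ.* (N ℕ.* G) ≡ c ℕ.* (a ℕ.* M) ℕ.+ a ℕ.* (a ℕ.* M)
  eq′ = trans (lem₂ N c a F G) (trans eq (lem₁ a c M))

coprime-power : ∀ {a N} k → Coprime a N → a ∣ N ℕ.^ k → a ≡ 1
coprime-power zero    cop a∣1  = ∣1⇒≡1 a∣1
coprime-power (suc k) cop a∣NM = coprime-power k cop (coprime-divisor cop a∣NM)

-- Without atoms a² divides the left side of the fixed-point equation, so a divides
-- (c + a)^k, to which it is coprime.
balanced-or-unit : ∀ {k} (f : BoolFun k) c a .{{_ : NonZero c}} .{{_ : NonZero a}} →
  Monotone f → f (zeros k) ≡ false → Coprime a (c ℕ.+ a) →
  (c ℕ.+ a) ℕ.* hom f c a ≡ a ℕ.* (c ℕ.+ a) ℕ.^ k →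
  2 ℕ.* trues f ≡ 2 ℕ.^ k ⊎ a ≡ 1
balanced-or-unit {k} f c a mono f0 cop eq with atom? f
... | yes h = inj₁ (atom-balanced f c a mono h eq)
... | no ¬h = inj₂ (coprime-power k cop (*-cancelˡ-∣ a
  (subst (a ℕ.* a ∣_) eq (∣n⇒∣m*n (c ℕ.+ a) (²∣-hom f c a f0 ¬h)))))

-- The fixed-point equation passes to the dual with a and c exchanged. If neither
-- f nor its dual is found balanced, then a = c = 1 and the equation itself says
-- that f is balanced.
fixed⇒balanced : ∀ {k} (f : BoolFun k) c a .{{_ : NonZero c}} .{{_ : NonZero a}} →
  Monotone f → f (zeros k) ≡ false → dual f (zeros k) ≡ false → Coprime a (c ℕ.+ a) →
  (c ℕ.+ a) ℕ.* hom f c a ≡ a ℕ.* (c ℕ.+ a) ℕ.^ k →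
  2 ℕ.* trues f ≡ 2 ℕ.^ k
fixed⇒balanced {k} f c a mono f0 f*0 cop eq
  with balanced-or-unit f c a mono f0 cop eq
     | balanced-or-unit (dual f) a c (dual-monotone {f = f} mono) f*0 cop* eq*
  where
  cop* : Coprime c (a ℕ.+ c)
  cop* {d} (d∣c , d∣a+c) = cop (∣m+n∣m⇒∣n d∣c+a d∣c , d∣c+a)
    where
    d∣c+a : d ∣ c ℕ.+ a
    d∣c+a = subst (d ∣_) (ℕ.+-comm a c) d∣a+c
  M = (c ℕ.+ a) ℕ.^ k
  H = hom f c a
  D = hom (dual f) a c
  eq* : (a ℕ.+ c) ℕ.* D ≡ c ℕ.* (a ℕ.+ c) ℕ.^ k
  eq* rewrite ℕ.+-comm a c = ℕ.+-cancelʳ-≡ (a ℕ.* M) ((c ℕ.+ a) ℕ.* D) (c ℕ.* M) (begin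
    (c ℕ.+ a) ℕ.* D ℕ.+ a ℕ.* M              ≡⟨ cong ((c ℕ.+ a) ℕ.* D ℕ.+_) eq ⟨
    (c ℕ.+ a) ℕ.* D ℕ.+ (c ℕ.+ a) ℕ.* H      ≡⟨ ℕ.*-distribˡ-+ (c ℕ.+ a) D H ⟨
    (c ℕ.+ a) ℕ.* (D ℕ.+ H)                  ≡⟨ cong ((c ℕ.+ a) ℕ.*_) (hom-dual f c a) ⟩
    (c ℕ.+ a) ℕ.* M                          ≡⟨ ℕ.*-distribʳ-+ M c a ⟩
    c ℕ.* M ℕ.+ a ℕ.* M                      ∎)
    where open ≡-Reasoning
... | inj₁ bal  | _         = bal
... | inj₂ _    | inj₁ bal* =
  trans (cong (2 ℕ.*_) (ℕ.+-cancelˡ-≡ D₁ (trues f) D₁ (begin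
    D₁ ℕ.+ trues f        ≡⟨ hom-dual f 1 1 ⟩
    2 ℕ.^ k               ≡⟨ bal* ⟨
    2 ℕ.* D₁              ≡⟨ cong (D₁ ℕ.+_) (ℕ.+-identityʳ D₁) ⟩
    D₁ ℕ.+ D₁             ∎))) bal*
  where
  open ≡-Reasoning
  D₁ = trues (dual f)
... | inj₂ refl | inj₂ refl = trans eq (ℕ.+-identityʳ (2 ℕ.^ k))

-- Naturals inside ℚ

fromℕ-+ : ∀ m n → fromℕ (m ℕ.+ n) ≡ fromℕ m + fromℕ n
fromℕ-+ zero    n = sym (ℚ.+-identityˡ (fromℕ n))
fromℕ-+ (suc m) n = trans (cong (_+_ 1ℚ) (fromℕ-+ m n)) (sym (ℚ.+-assoc 1ℚ (fromℕ m) (fromℕ n)))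

fromℕ-* : ∀ m n → fromℕ (m ℕ.* n) ≡ fromℕ m * fromℕ n
fromℕ-* zero    n = sym (ℚ.*-zeroˡ (fromℕ n))
fromℕ-* (suc m) n = begin
  fromℕ (n ℕ.+ m ℕ.* n)              ≡⟨ fromℕ-+ n (m ℕ.* n) ⟩
  fromℕ n + fromℕ (m ℕ.* n)          ≡⟨ cong (_+_ (fromℕ n)) (fromℕ-* m n) ⟩
  fromℕ n + fromℕ m * fromℕ n        ≡⟨ lem (fromℕ m) (fromℕ n) ⟩
  (1ℚ + fromℕ m) * fromℕ n           ∎
  where
  open ≡-Reasoning
  lem : ∀ x y → y + x * y ≡ (1ℚ + x) * y
  lem = solve-∀ ringℚ

0<fromℕ-suc : ∀ n → 0ℚ < fromℕ (suc n)
0<fromℕ-suc n = ℚ.+-mono-<-≤ 0<1 (0≤fromℕ n)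

fromℕ-injective : ∀ {m n} → fromℕ m ≡ fromℕ n → m ≡ n
fromℕ-injective {zero}  {zero}  _  = refl
fromℕ-injective {zero}  {suc n} eq = ⊥-elim (ℚ.<⇒≢ (0<fromℕ-suc n) eq)
fromℕ-injective {suc m} {zero}  eq = ⊥-elim (ℚ.<⇒≢ (0<fromℕ-suc m) (sym eq))
fromℕ-injective {suc m} {suc n} eq = cong suc (fromℕ-injective (begin
  fromℕ m                  ≡⟨ lem (fromℕ m) ⟩
  fromℕ (suc m) - 1ℚ       ≡⟨ cong (_- 1ℚ) eq ⟩
  fromℕ (suc n) - 1ℚ       ≡⟨ lem (fromℕ n) ⟨
  fromℕ n                  ∎))
  where
  open ≡-Reasoning
  lem : ∀ x → x ≡ (1ℚ + x) - 1ℚ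
  lem = solve-∀ ringℚ

toℚᵘ-fromℕ : ∀ n → toℚᵘ (fromℕ n) ℚᵘ.≃ mkℚᵘ (+ n) 0
toℚᵘ-fromℕ zero    = ℚᵘ.≃-refl
toℚᵘ-fromℕ (suc n) = ℚᵘ.≃-trans (ℚ.toℚᵘ-homo-+ 1ℚ (fromℕ n))
  (ℚᵘ.≃-trans (ℚᵘ.+-congʳ (toℚᵘ 1ℚ) (toℚᵘ-fromℕ n))
    (ℚᵘ.≃-reflexive (cong (λ z → mkℚᵘ z 0)
      (cong (λ z → + 1 ℤ.+ z) (ℤ.*-identityʳ (+ n))))))

fromℕ≡/1 : ∀ n → fromℕ n ≡ + n /ℚ 1
fromℕ≡/1 n = ℚ.toℚᵘ-injective
  (ℚᵘ.≃-trans (toℚᵘ-fromℕ n) (ℚᵘ.≃-sym (ℚ.toℚᵘ-fromℚᵘ (mkℚᵘ (+ n) 0))))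

-- A rational represented by the fraction a / (d + 1), in lowest terms or not.
ratio : ∀ q a d → toℚᵘ q ℚᵘ.≃ mkℚᵘ (+ a) d → q * fromℕ (suc d) ≡ fromℕ a
ratio q a d q≃ = ℚ.toℚᵘ-injective
  (ℚᵘ.≃-trans (ℚ.toℚᵘ-homo-* q (fromℕ (suc d)))
  (ℚᵘ.≃-trans (ℚᵘ.*-cong q≃ (toℚᵘ-fromℕ (suc d)))
  (ℚᵘ.≃-trans cancel (ℚᵘ.≃-sym (toℚᵘ-fromℕ a)))))
  where
  cancel : mkℚᵘ (+ a) d ℚᵘ.* mkℚᵘ (+ suc d) 0 ℚᵘ.≃ mkℚᵘ (+ a) 0
  cancel = *≡* (trans (ℤ.*-identityʳ _)
    (cong (λ m → + a ℤ.* + m) (sym (ℕ.*-identityʳ (suc d)))))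

1/n*n : ∀ n .{{_ : NonZero n}} → (+ 1 /ℚ n) * fromℕ n ≡ 1ℚ
1/n*n (suc d) = trans
  (ratio (+ 1 /ℚ suc d) 1 d (ℚ.toℚᵘ-fromℚᵘ (mkℚᵘ (+ 1) d))) (ℚ.+-identityʳ 1ℚ)

0<1/n : ∀ n .{{_ : NonZero n}} → 0ℚ < + 1 /ℚ n
0<1/n n = ℚ.positive⁻¹ (+ 1 /ℚ n) {{ℚ.normalize-pos 1 n}}

-- A rational in (0,1) as a/(c + a) in lowest terms.
record Fraction (q : ℚ) : Set where
  field
    a c      : ℕ
    a≢0      : NonZero a
    c≢0      : NonZero c
    coprime  : Coprime a (c ℕ.+ a)
    q*N≡a    : q * fromℕ (c ℕ.+ a) ≡ fromℕ a

fraction : ∀ q → 0ℚ < q → q < 1ℚ → Fraction q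
fraction (mkℚ (+ zero) _ _)       (*<* (ℤ.+<+ ())) _
fraction (mkℚ (ℤ.-[1+_] _) _ _)   (*<* ()) _
fraction q@(mkℚ (+ suc a) d cop) _ (*<* (ℤ.+<+ a*1<1*N)) = record
  { a = suc a ; c = suc d ℕ.∸ suc a ; a≢0 = _ ; c≢0 = ℕ.>-nonZero (ℕ.m<n⇒0<n∸m a<N)
  ; coprime = subst (Coprime (suc a)) (sym N≡) (recompute cop)
  ; q*N≡a = trans (cong (λ N → q * fromℕ N) N≡) (ratio q (suc a) d ℚᵘ.≃-refl) }
  where
  a<N : suc a ℕ.< suc d
  a<N = subst₂ ℕ._<_ (ℕ.*-identityʳ (suc a)) (ℕ.*-identityˡ (suc d)) a*1<1*N
  N≡ : (suc d ℕ.∸ suc a) ℕ.+ suc a ≡ suc d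
  N≡ = ℕ.m∸n+n≡m (ℕ.<⇒≤ a<N)

charℚ-hom : ∀ {k} (f : BoolFun k) {q} c a → q * fromℕ (c ℕ.+ a) ≡ fromℕ a →
  charℚ f q * fromℕ ((c ℕ.+ a) ℕ.^ k) ≡ fromℕ (hom f c a)
charℚ-hom {zero} f c a _ with f []
... | true  = refl
... | false = refl
charℚ-hom {suc k} f {q} c a q*N = begin
  ((1ℚ - q) * F + q * G) * fromℕ (N ℕ.* M)
    ≡⟨ cong (((1ℚ - q) * F + q * G) *_) (fromℕ-* N M) ⟩
  ((1ℚ - q) * F + q * G) * (fromℕ N * fromℕ M)
    ≡⟨ lem₁ q F G (fromℕ N) (fromℕ M) ⟩
  (fromℕ N - q * fromℕ N) * (F * fromℕ M) + (q * fromℕ N) * (G * fromℕ M)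
    ≡⟨ cong₂ _+_
         (cong₂ _*_ (trans (cong₂ _-_ (fromℕ-+ c a) q*N) (lem₂ (fromℕ c) (fromℕ a)))
                    (charℚ-hom (restrict false f) c a q*N))
         (cong₂ _*_ q*N (charℚ-hom (restrict true f) c a q*N)) ⟩
  fromℕ c * fromℕ F′ + fromℕ a * fromℕ G′
    ≡⟨ cong₂ _+_ (fromℕ-* c F′) (fromℕ-* a G′) ⟨
  fromℕ (c ℕ.* F′) + fromℕ (a ℕ.* G′)
    ≡⟨ fromℕ-+ (c ℕ.* F′) (a ℕ.* G′) ⟨
  fromℕ (c ℕ.* F′ ℕ.+ a ℕ.* G′) ∎
  where
  open ≡-Reasoning
  N = c ℕ.+ a
  M = N ℕ.^ k
  F = charℚ (restrict false f) q
  G = charℚ (restrict true f) q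
  F′ = hom (restrict false f) c a
  G′ = hom (restrict true f) c a
  lem₁ : ∀ q F G N M → ((1ℚ - q) * F + q * G) * (N * M)
                     ≡ (N - q * N) * (F * M) + (q * N) * (G * M)
  lem₁ = solve-∀ ringℚ
  lem₂ : ∀ c a → (c + a) - a ≡ c
  lem₂ = solve-∀ ringℚ

no-rational-fixed-point : ∀ {k} (f : BoolFun k) → Monotone f →
  f (zeros k) ≡ false → dual f (zeros k) ≡ false → ¬ (2 ℕ.* trues f ≡ 2 ℕ.^ k) →
  ∀ {q} → 0ℚ < q → q < 1ℚ → ¬ (charℚ f q ≡ q)
no-rational-fixed-point {k} f mono f0 f*0 unbal {q} 0<q q<1 fix =
  unbal (fixed⇒balanced f c a {{c≢0}} {{a≢0}} mono f0 f*0 coprime (fromℕ-injective (begin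
    fromℕ (N ℕ.* hom f c a)                ≡⟨ fromℕ-* N (hom f c a) ⟩
    fromℕ N * fromℕ (hom f c a)            ≡⟨ cong (fromℕ N *_) (charℚ-hom f c a q*N≡a) ⟨
    fromℕ N * (charℚ f q * fromℕ M)        ≡⟨ cong (λ r → fromℕ N * (r * fromℕ M)) fix ⟩
    fromℕ N * (q * fromℕ M)                ≡⟨ lem q (fromℕ N) (fromℕ M) ⟩
    (q * fromℕ N) * fromℕ M                ≡⟨ cong (_* fromℕ M) q*N≡a ⟩
    fromℕ a * fromℕ M                      ≡⟨ fromℕ-* a M ⟨
    fromℕ (a ℕ.* M)                        ∎)))
  where
  open ≡-Reasoning
  open Fraction (fraction q 0<q q<1)
  N = c ℕ.+ a
  M = N ℕ.^ k
  lem : ∀ q N M → N * (q * M) ≡ (q * N) * M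
  lem = solve-∀ ringℚ

-- Archimedean property and absolute values

archimedean : ∀ r → 0ℚ < r → ∃[ N ] 1ℚ ≤ fromℕ N * r
archimedean (mkℚ (+ zero) _ _)     (*<* (ℤ.+<+ ()))
archimedean (mkℚ (ℤ.-[1+_] _) _ _) (*<* ())
archimedean r@(mkℚ (+ suc a) d _) _ = suc d ,
  ≤-excess (fromℕ a) (0≤fromℕ a)
    (trans (ℚ.*-comm (fromℕ (suc d)) r) (ratio r (suc a) d ℚᵘ.≃-refl))

fromℕ-mono : ∀ {m n} → m ℕ.≤ n → fromℕ m ≤ fromℕ n
fromℕ-mono {n = n} ℕ.z≤n   = 0≤fromℕ n
fromℕ-mono (ℕ.s≤s m≤n) = ℚ.+-monoʳ-≤ 1ℚ (fromℕ-mono m≤n)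

p≤∣p∣ : ∀ p → p ≤ ∣ p ∣
p≤∣p∣ p with ℚ.≤-total 0ℚ p
... | inj₁ 0≤p = ℚ.≤-reflexive (sym (ℚ.0≤p⇒∣p∣≡p 0≤p))
... | inj₂ p≤0 = ℚ.≤-trans p≤0 (ℚ.0≤∣p∣ p)

q-p≤∣p-q∣ : ∀ p q → q - p ≤ ∣ p - q ∣
q-p≤∣p-q∣ p q = subst (q - p ≤_)
  (trans (cong ∣_∣ (lem p q)) (ℚ.∣-p∣≡∣p∣ (p - q))) (p≤∣p∣ (q - p))
  where
  lem : ∀ p q → q - p ≡ - (p - q)
  lem = solve-∀ ringℚ

-- Iterating the characteristic polynomial

-- A shrinks each s in [0,q] by at least the factor 1 - κ.
Contracts : ∀ {k} → BoolFun k → ℚ → ℚ → Set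
Contracts f q κ = 0ℚ < κ × (∀ s → 0ℚ ≤ s → s ≤ q → charℚ f s + κ * s ≤ s)

-- Either q = 0, or q lies in (0,1) and A(q) < q.
Subcritical : ∀ {k} → BoolFun k → ℚ → Set
Subcritical f q = q ≡ 0ℚ ⊎ (0ℚ < q × q < 1ℚ × charℚ f q < q)

charℚ-zero : ∀ {k} (f : BoolFun k) → f (zeros k) ≡ false → charℚ f 0ℚ ≡ 0ℚ
charℚ-zero {zero}  f f0 rewrite f0 = refl
charℚ-zero {suc k} f f0 rewrite charℚ-zero (restrict false f) f0 =
  lem (charℚ (restrict true f) 0ℚ)
  where
  lem : ∀ G → (1ℚ - 0ℚ) * 0ℚ + 0ℚ * G ≡ 0ℚ
  lem = solve-∀ ringℚ

subcritical⇒contracts : ∀ {k} (f : BoolFun k) → Monotone f → f (zeros k) ≡ false →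
  ∀ {q} → Subcritical f q → ∃[ κ ] Contracts f q κ
subcritical⇒contracts f mono f0 (inj₁ refl) = 1ℚ , 0<1 , at-zero
  where
  at-zero : ∀ s → 0ℚ ≤ s → s ≤ 0ℚ → charℚ f s + 1ℚ * s ≤ s
  at-zero s 0≤s s≤0 rewrite ℚ.≤-antisym s≤0 0≤s | charℚ-zero f f0 = ℚ.≤-refl
subcritical⇒contracts f mono f0 {q} (inj₂ (0<q , q<1 , b<q)) =
  (q - charℚ f q) * (1ℚ - q) , 0<* (<⇒0<- b<q) (<⇒0<- q<1) ,
  λ s 0≤s s≤q → charℚ-contraction f mono (0≤s , ℚ.≤-trans s≤q (ℚ.<⇒≤ q<1)) s≤q
                  (ℚ.<⇒≤ 0<q , ℚ.<⇒≤ q<1) b<q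

-- The geometric decay y i ≤ (1-κ)^i is weakened to y i ≤ 1/(1 + iκ), which
-- needs no powers and follows by induction on i.
iterate-bound : ∀ {k} (f : BoolFun k) {q κ} → Contracts f q κ → (y : ℕ → ℚ) →
  (∀ i → 0ℚ ≤ y i) → (∀ i → y (suc i) ≡ charℚ f (y i)) → y 0 ≤ q → q ≤ 1ℚ →
  ∀ i → y i ≤ q × y i * (1ℚ + fromℕ i * κ) ≤ 1ℚ
iterate-bound f {q} {κ} contr y 0≤y step y0≤q q≤1 zero =
  y0≤q , ≤-excess (1ℚ - y 0) (≤⇒0≤- (ℚ.≤-trans y0≤q q≤1)) (lem (y 0) κ)
  where
  lem : ∀ y κ → 1ℚ ≡ y * (1ℚ + 0ℚ * κ) + (1ℚ - y)
  lem = solve-∀ ringℚ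
iterate-bound f {q} {κ} (0<κ , contr) y 0≤y step y0≤q q≤1 (suc i) =
  ℚ.≤-trans (≤-excess _ (0≤+ 0≤drop (0≤* 0≤κ (0≤y i))) (lem₁ (y i) y′ κ)) (proj₁ ih) ,
  ≤-excess _
    (0≤+ (0≤+ (0≤* 0≤drop (0≤+ 0≤1 (0≤* (0≤+ 0≤1 (0≤fromℕ i)) 0≤κ))) (≤⇒0≤- (proj₂ ih)))
         (0≤* (0≤y i) (0≤* (0≤* 0≤κ 0≤κ) (0≤+ 0≤1 (0≤fromℕ i)))))
    (lem₂ (y i) y′ κ (fromℕ i))
  where
  y′ = y (suc i)
  0≤κ = ℚ.<⇒≤ 0<κ
  ih = iterate-bound f (0<κ , contr) y 0≤y step y0≤q q≤1 i
  0≤drop : 0ℚ ≤ y i - (y′ + κ * y i)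
  0≤drop = ≤⇒0≤- (subst (λ z → z + κ * y i ≤ y i) (sym (step i)) (contr (y i) (0≤y i) (proj₁ ih)))
  lem₁ : ∀ y y′ κ → y ≡ y′ + (y - (y′ + κ * y) + κ * y)
  lem₁ = solve-∀ ringℚ
  lem₂ : ∀ y y′ κ c → 1ℚ ≡ y′ * (1ℚ + (1ℚ + c) * κ)
    + ((y - (y′ + κ * y)) * (1ℚ + (1ℚ + c) * κ) + (1ℚ - y * (1ℚ + c * κ))
       + y * (κ * κ * (1ℚ + c)))
  lem₂ = solve-∀ ringℚ

-- The threshold N depends on κ and ε only, so it serves all starting points at
-- once.
harmonic-decay : ∀ {κ} → 0ℚ < κ → ∀ {ε} → 0ℚ < ε →
  ∃[ N ] (∀ i → N ℕ.≤ i → ∀ y → y * (1ℚ + fromℕ i * κ) ≤ 1ℚ → y < ε)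
harmonic-decay {κ} 0<κ {ε} 0<ε with archimedean (κ * ε) (0<* 0<κ 0<ε)
... | N , 1≤Nκε = N , small
  where
  small : ∀ i → N ℕ.≤ i → ∀ y → y * (1ℚ + fromℕ i * κ) ≤ 1ℚ → y < ε
  small i N≤i y y≤ with y ℚ.<? ε
  ... | yes y<ε = y<ε
  ... | no y≮ε = ⊥-elim (ℚ.<-irrefl refl (ℚ.<-≤-trans 1<εh εh≤1))
    where
    h = 1ℚ + fromℕ i * κ
    0≤h : 0ℚ ≤ h
    0≤h = 0≤+ 0≤1 (0≤* (0≤fromℕ i) (ℚ.<⇒≤ 0<κ))
    lem : ∀ ε i κ → ε * (1ℚ + i * κ) ≡ i * (κ * ε) + ε
    lem = solve-∀ ringℚ
    εh≤1 : ε * h ≤ 1ℚ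
    εh≤1 = ℚ.≤-trans (*-monoʳ 0≤h (ℚ.≮⇒≥ y≮ε)) y≤
    1<εh : 1ℚ < ε * h
    1<εh = ℚ.≤-<-trans
      (ℚ.≤-trans 1≤Nκε (*-monoʳ (ℚ.<⇒≤ (0<* 0<κ 0<ε)) (fromℕ-mono N≤i)))
      (<-excess ε 0<ε (lem ε (fromℕ i) κ))

-- Locating the fixed point

-- Approximations s i to a fixed point of A, eventually at distance at least δ from
-- 0 and from 1.
record ApproachesFixedPoint {k} (f : BoolFun k) (s : ℕ → ℚ) : Set where
  field
    δ      : ℚ
    0<δ    : 0ℚ < δ
    from   : ℕ
    δ≤s    : ∀ i → from ℕ.≤ i → δ ≤ s i
    s≤1-δ  : ∀ i → from ℕ.≤ i → s i ≤ 1ℚ - δ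
    fixed  : ∀ ε → 0ℚ < ε → ∃[ N ] (∀ i → N ℕ.≤ i → ∣ charℚ f (s i) - s i ∣ < ε)

open ApproachesFixedPoint

dual-approaches : ∀ {k} {f : BoolFun k} {s} → ApproachesFixedPoint f s →
  ApproachesFixedPoint (dual f) (λ i → 1ℚ - s i)
dual-approaches {f = f} {s} A = record
  { δ = δ A ; 0<δ = 0<δ A ; from = from A
  ; δ≤s = λ i i≥ → 0≤-⇒≤ (subst (0ℚ ≤_) (lem₁ (δ A) (s i)) (≤⇒0≤- (s≤1-δ A i i≥)))
  ; s≤1-δ = λ i i≥ → 0≤-⇒≤ (subst (0ℚ ≤_) (lem₂ (δ A) (s i)) (≤⇒0≤- (δ≤s A i i≥)))
  ; fixed = λ ε 0<ε → let N , h = fixed A ε 0<ε in N , λ i i≥ →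
      subst (_< ε) (trans (sym (ℚ.∣-p∣≡∣p∣ _))
        (cong ∣_∣ (trans (lem₃ (charℚ f (s i)) (s i))
          (cong (_- (1ℚ - s i)) (sym (charℚ-dual f (s i))))))) (h i i≥)
  }
  where
  lem₁ : ∀ δ s → (1ℚ - δ) - s ≡ (1ℚ - s) - δ
  lem₁ = solve-∀ ringℚ
  lem₂ : ∀ δ s → s - δ ≡ (1ℚ - δ) - (1ℚ - s)
  lem₂ = solve-∀ ringℚ
  lem₃ : ∀ c s → - (c - s) ≡ (1ℚ - c) - (1ℚ - s)
  lem₃ = solve-∀ ringℚ

-- Otherwise f is constantly true and A = 1 has no fixed point below 1.
approaches⇒zeros-false : ∀ {k} (f : BoolFun k) → Monotone f → ∀ {s} →
  ApproachesFixedPoint f s → f (zeros k) ≡ false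
approaches⇒zeros-false {k} f mono {s} A = ≢true⇒≡false impossible
  where
  N = proj₁ (fixed A (δ A) (0<δ A))
  i = N ℕ.⊔ from A
  impossible : ¬ (f (zeros k) ≡ true)
  impossible f0 = ℚ.<-irrefl refl (ℚ.≤-<-trans
    (ℚ.≤-trans δ≤1-s (p≤∣p∣ (1ℚ - s i)))
    (subst (λ c → ∣ c - s i ∣ < δ A) (charℚ-true f (s i) (monotone-true f mono f0))
      (proj₂ (fixed A (δ A) (0<δ A)) i (ℕ.m≤m⊔n N (from A)))))
    where
    lem : ∀ δ s → (1ℚ - δ) - s ≡ (1ℚ - s) - δ
    lem = solve-∀ ringℚ
    δ≤1-s : δ A ≤ 1ℚ - s i
    δ≤1-s = 0≤-⇒≤ (subst (0ℚ ≤_) (lem (δ A) (s i))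
      (≤⇒0≤- (s≤1-δ A i (ℕ.m≤n⊔m N (from A)))))

-- A fixed point s ≤ q would satisfy κ s ≤ s - A(s) = 0, contradicting s ≥ δ;
-- the approximations s i do so up to the error κ δ.
contracts⇒below : ∀ {k} (f : BoolFun k) {q κ} → Contracts f q κ → ∀ {s} →
  ApproachesFixedPoint f s → ∃[ N ] (∀ i → N ℕ.≤ i → q < s i)
contracts⇒below f {q} {κ} (0<κ , contr) {s} A = N ℕ.⊔ from A , below
  where
  0<κδ = 0<* 0<κ (0<δ A)
  N = proj₁ (fixed A (κ * δ A) 0<κδ)
  below : ∀ i → N ℕ.⊔ from A ℕ.≤ i → q < s i
  below i i≥ = ℚ.≰⇒> λ s≤q → ℚ.<-irrefl refl (begin-strict
    κ * δ A                  ≤⟨ *-monoˡ (ℚ.<⇒≤ 0<κ) δ≤si ⟩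
    κ * s i                  ≤⟨ 0≤-⇒≤ (subst (0ℚ ≤_) (lem (s i) (charℚ f (s i)) (κ * s i))
                                  (≤⇒0≤- (contr (s i) (ℚ.≤-trans (ℚ.<⇒≤ (0<δ A)) δ≤si) s≤q))) ⟩
    s i - charℚ f (s i)      ≤⟨ q-p≤∣p-q∣ (charℚ f (s i)) (s i) ⟩
    ∣ charℚ f (s i) - s i ∣  <⟨ proj₂ (fixed A (κ * δ A) 0<κδ) i (ℕ.m⊔n≤o⇒m≤o N (from A) i≥) ⟩
    κ * δ A                  ∎)
    where
    open ℚ.≤-Reasoning
    δ≤si = δ≤s A i (ℕ.m⊔n≤o⇒n≤o N (from A) i≥)
    lem : ∀ s c d → s - (c + d) ≡ (s - c) - d
    lem = solve-∀ ringℚ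

-- The sequence s eventually exceeds q by a fixed positive amount.
StrictlyBelow : ℚ → (ℕ → ℚ) → Set
StrictlyBelow q s = ∃[ ε ] (0ℚ < ε × ∃[ N ] (∀ i → N ℕ.≤ i → q + ε < s i))

-- By Lipschitz continuity A(q + ε) < q + ε for a small ε, so that the fixed point
-- lies above q + ε and not merely above q.
subcritical⇒below : ∀ {k} (f : BoolFun k) → Monotone f → f (zeros k) ≡ false →
  ∀ {s} → ApproachesFixedPoint f s → ∀ {q} → Subcritical f q → StrictlyBelow q s
subcritical⇒below f mono f0 {s} A (inj₁ refl) =
  ½ * δ A , 0<½δ , from A , λ i i≥ → ℚ.<-≤-trans (<-excess (½ * δ A) 0<½δ (lem₂ (δ A))) (δ≤s A i i≥)
  where
  0<½δ = 0<* (ℚ.positive⁻¹ ½) (0<δ A)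
  lem₂ : ∀ d → d ≡ (0ℚ + ½ * d) + ½ * d
  lem₂ d = trans (sym (ℚ.*-identityˡ d)) (trans (ℚ.*-distribʳ-+ d ½ ½)
    (cong (_+ ½ * d) (sym (ℚ.+-identityˡ (½ * d)))))
subcritical⇒below {k} f mono f0 {s} A {q} (inj₂ (0<q , q<1 , b<q)) =
  ε , 0<ε , contracts⇒below f (proj₂ (subcritical⇒contracts f mono f0 q+ε-subcritical)) A
  where
  r = + 1 /ℚ suc k
  b = charℚ f q
  0<r : 0ℚ < r
  0<r = 0<1/n (suc k)
  0<d = <⇒0<- b<q
  -- The factor r = 1/(k + 1) offsets the Lipschitz constant k, and the factor
  -- 1 - q keeps q + ε below 1.
  ε = (q - b) * (1ℚ - q) * r
  0<ε : 0ℚ < ε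
  0<ε = 0<* (0<* 0<d (<⇒0<- q<1)) 0<r
  rk : r * (1ℚ + fromℕ k) ≡ 1ℚ
  rk = 1/n*n (suc k)
  0≤q = ℚ.<⇒≤ 0<q
  0≤d = ℚ.<⇒≤ 0<d
  0≤b = proj₁ (charℚ-𝕀 f (0≤q , ℚ.<⇒≤ q<1))
  0≤1-q = ℚ.<⇒≤ (<⇒0<- q<1)
  0≤r = ℚ.<⇒≤ 0<r
  0≤1-r : 0ℚ ≤ 1ℚ - r
  0≤1-r = ≤⇒0≤- {r} (≤-excess {r} (r * fromℕ k) (0≤* 0≤r (0≤fromℕ k)) (trans (sym rk) (lem r (fromℕ k))))
    where
    lem : ∀ r k → r * (1ℚ + k) ≡ r + r * k
    lem = solve-∀ ringℚ
  q+ε<1 : q + ε < 1ℚ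
  q+ε<1 = <-excess ((1ℚ - q) * (b + (1ℚ - q) + (q - b) * (1ℚ - r)))
    (0<* (<⇒0<- q<1) (ℚ.<-≤-trans (<⇒0<- q<1)
      (≤-excess (b + (q - b) * (1ℚ - r)) (0≤+ 0≤b (0≤* 0≤d 0≤1-r)) (lem₁ q b r))))
    (lem₂ q b r)
    where
    lem₁ : ∀ q b r → b + (1ℚ - q) + (q - b) * (1ℚ - r) ≡ (1ℚ - q) + (b + (q - b) * (1ℚ - r))
    lem₁ = solve-∀ ringℚ
    lem₂ : ∀ q b r → 1ℚ ≡ (q + (q - b) * (1ℚ - q) * r)
      + (1ℚ - q) * (b + (1ℚ - q) + (q - b) * (1ℚ - r))
    lem₂ = solve-∀ ringℚ
  q≤q+ε : q ≤ q + ε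
  q≤q+ε = ≤-excess ε (ℚ.<⇒≤ 0<ε) refl
  0<q+ε = ℚ.<-≤-trans 0<q q≤q+ε
  kε≤ : b + fromℕ k * ((q + ε) - q) < q + ε
  kε≤ = <-excess (ε + ((q - b) * r + fromℕ k * ((q - b) * r * q)))
    (ℚ.+-mono-<-≤ 0<ε (0≤+ (0≤* 0≤d 0≤r) (0≤* (0≤fromℕ k) (0≤* (0≤* 0≤d 0≤r) 0≤q))))
    (trans (cong (_+ ε) (trans (lem₁ q b) (cong (λ z → b + (q - b) * z) (sym rk)))) (lem₂ q b r (fromℕ k)))
    where
    lem₁ : ∀ q b → q ≡ b + (q - b) * 1ℚ
    lem₁ = solve-∀ ringℚ
    lem₂ : ∀ q b r k → (b + (q - b) * (r * (1ℚ + k))) + (q - b) * (1ℚ - q) * r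
      ≡ (b + k * ((q + (q - b) * (1ℚ - q) * r) - q))
        + ((q - b) * (1ℚ - q) * r + ((q - b) * r + k * ((q - b) * r * q)))
    lem₂ = solve-∀ ringℚ
  q+ε-subcritical : Subcritical f (q + ε)
  q+ε-subcritical = inj₂ (0<q+ε , q+ε<1 , ℚ.≤-<-trans
    (charℚ-Lipschitz f (0≤q , ℚ.<⇒≤ q<1) q≤q+ε (ℚ.<⇒≤ 0<q+ε , ℚ.<⇒≤ q+ε<1)) kε≤)

subcritical-or-dual : ∀ {k} (f : BoolFun k) → Monotone f →
  f (zeros k) ≡ false → dual f (zeros k) ≡ false → ¬ (2 ℕ.* trues f ≡ 2 ℕ.^ k) →
  ∀ {q} → 𝕀 q → Subcritical f q ⊎ Subcritical (dual f) (1ℚ - q)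
subcritical-or-dual f mono f0 f*0 unbal {q} (0≤q , q≤1) with ℚ.<-cmp 0ℚ q | ℚ.<-cmp q 1ℚ
... | tri≈ _ 0≡q _ | _             = inj₁ (inj₁ (sym 0≡q))
... | tri> _ _ q<0 | _             = ⊥-elim (ℚ.<-irrefl refl (ℚ.<-≤-trans q<0 0≤q))
... | tri< _ _ _   | tri≈ _ refl _ = inj₂ (inj₁ (ℚ.+-inverseʳ 1ℚ))
... | tri< _ _ _   | tri> _ _ 1<q  = ⊥-elim (ℚ.<-irrefl refl (ℚ.<-≤-trans 1<q q≤1))
... | tri< 0<q _ _ | tri< q<1 _ _ with ℚ.<-cmp (charℚ f q) q
... | tri< b<q _ _ = inj₁ (inj₂ (0<q , q<1 , b<q))
... | tri≈ _ b≡q _ = ⊥-elim (no-rational-fixed-point f mono f0 f*0 unbal 0<q q<1 b≡q)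
... | tri> _ _ q<b = inj₂ (inj₂ (<⇒0<- q<1 , <-excess q 0<q (lem₁ q) ,
  subst (_< 1ℚ - q) (sym (charℚ-dual f q))
    (0<-⇒< (subst (0ℚ <_) (lem₂ q (charℚ f q)) (<⇒0<- q<b)))))
  where
  lem₁ : ∀ q → 1ℚ ≡ (1ℚ - q) + q
  lem₁ = solve-∀ ringℚ
  lem₂ : ∀ q b → b - q ≡ (1ℚ - q) - (1ℚ - b)
  lem₂ = solve-∀ ringℚ

-- If each w ≤ n satisfies P or Q, with P at 0 and Q at n, then P at some m < n is
-- followed by Q at m + 1.
crossing : ∀ {P Q : ℕ → Set} n .{{_ : NonZero n}} → P 0 → Q n →
  (∀ w → w ℕ.≤ n → P w ⊎ Q w) → ∃[ m ] (suc m ℕ.≤ n × P m × Q (suc m))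
crossing {P} {Q} (suc n) = search n
  where
  search : ∀ n → P 0 → Q (suc n) → (∀ w → w ℕ.≤ suc n → P w ⊎ Q w) →
    ∃[ m ] (suc m ℕ.≤ suc n × P m × Q (suc m))
  search zero    p q _ = 0 , ℕ.≤-refl , p , q
  search (suc n) p q dec with dec (suc n) (ℕ.n≤1+n (suc n))
  ... | inj₁ p′ = suc n , ℕ.≤-refl , p′ , q
  ... | inj₂ q′ with search n p q′ (λ w w≤ → dec w (ℕ.≤-trans w≤ (ℕ.n≤1+n (suc n))))
  ... | m , m<n , pm , qm = m , ℕ.≤-trans m<n (ℕ.n≤1+n (suc n)) , pm , qm

-- Finite sums

-- The sum of g over a list, with multiplicity.
∑ : {A : Set} → List A → (A → ℚ) → ℚ
∑ xs g = sumℚ (map g xs)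

module _ {A : Set} where

  ∑-cong : (xs : List A) {g h : A → ℚ} → (∀ x → g x ≡ h x) → ∑ xs g ≡ ∑ xs h
  ∑-cong xs g≗h = cong sumℚ (List.map-cong g≗h xs)

  ∑-++ : (xs ys : List A) (g : A → ℚ) → ∑ (xs ++ ys) g ≡ ∑ xs g + ∑ ys g
  ∑-++ []       ys g = sym (ℚ.+-identityˡ (∑ ys g))
  ∑-++ (x ∷ xs) ys g = trans (cong (_+_ (g x)) (∑-++ xs ys g)) (sym (ℚ.+-assoc (g x) (∑ xs g) (∑ ys g)))

  ∑-*ˡ : (xs : List A) (c : ℚ) (g : A → ℚ) → ∑ xs (λ x → c * g x) ≡ c * ∑ xs g
  ∑-*ˡ []       c g = sym (ℚ.*-zeroʳ c)
  ∑-*ˡ (x ∷ xs) c g = trans (cong (_+_ (c * g x)) (∑-*ˡ xs c g)) (sym (ℚ.*-distribˡ-+ c (g x) (∑ xs g)))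

  ∑-*ʳ : (xs : List A) (c : ℚ) (g : A → ℚ) → ∑ xs (λ x → g x * c) ≡ ∑ xs g * c
  ∑-*ʳ xs c g = trans (∑-cong xs (λ x → ℚ.*-comm (g x) c))
    (trans (∑-*ˡ xs c g) (ℚ.*-comm c (∑ xs g)))

  ∑-+ : (xs : List A) (g h : A → ℚ) → ∑ xs (λ x → g x + h x) ≡ ∑ xs g + ∑ xs h
  ∑-+ []       g h = refl
  ∑-+ (x ∷ xs) g h = trans (cong (_+_ (g x + h x)) (∑-+ xs g h)) (lem (g x) (h x) (∑ xs g) (∑ xs h))
    where
    lem : ∀ a b c d → (a + b) + (c + d) ≡ (a + c) + (b + d)
    lem = solve-∀ ringℚ

  ∑-zero : (xs : List A) → ∑ xs (λ _ → 0ℚ) ≡ 0ℚ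
  ∑-zero []       = refl
  ∑-zero (x ∷ xs) = trans (ℚ.+-identityˡ _) (∑-zero xs)

  ∑-mono : (xs : List A) {g h : A → ℚ} → (∀ x → g x ≤ h x) → ∑ xs g ≤ ∑ xs h
  ∑-mono []       _   = ℚ.≤-refl
  ∑-mono (x ∷ xs) g≤h = ℚ.+-mono-≤ (g≤h x) (∑-mono xs g≤h)

  ∑-nonneg : (xs : List A) {g : A → ℚ} → (∀ x → 0ℚ ≤ g x) → 0ℚ ≤ ∑ xs g
  ∑-nonneg xs 0≤g = subst (_≤ ∑ xs _) (∑-zero xs) (∑-mono xs 0≤g)

  ∑-const : (xs : List A) (c : ℚ) → ∑ xs (λ _ → c) ≡ fromℕ (length xs) * c
  ∑-const []       c = sym (ℚ.*-zeroˡ c)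
  ∑-const (x ∷ xs) c = trans (cong (_+_ c) (∑-const xs c)) (lem c (fromℕ (length xs)))
    where
    lem : ∀ c n → c + n * c ≡ (1ℚ + n) * c
    lem = solve-∀ ringℚ

∑-swap : ∀ {A B : Set} (xs : List A) (ys : List B) (g : A → B → ℚ) →
  ∑ xs (λ x → ∑ ys (g x)) ≡ ∑ ys (λ y → ∑ xs (λ x → g x y))
∑-swap []       ys g = sym (∑-zero ys)
∑-swap (x ∷ xs) ys g = trans (cong (_+_ (∑ ys (g x))) (∑-swap xs ys g))
  (sym (∑-+ ys (g x) (λ y → ∑ xs (λ x → g x y))))

∑-map : ∀ {A B : Set} (h : A → B) (xs : List A) (g : B → ℚ) → ∑ (map h xs) g ≡ ∑ xs (g ∘ h)
∑-map h xs g = cong sumℚ (sym (List.map-∘ xs))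

∑-cartesian : ∀ {A B C : Set} (h : A → B → C) (xs : List A) (ys : List B) (g : C → ℚ) →
  ∑ (cartesianProductWith h xs ys) g ≡ ∑ xs (λ x → ∑ ys (λ y → g (h x y)))
∑-cartesian h []       ys g = refl
∑-cartesian h (x ∷ xs) ys g = trans (∑-++ (map (h x) ys) (cartesianProductWith h xs ys) g)
  (cong₂ _+_ (∑-map (h x) ys g) (∑-cartesian h xs ys g))

-- The Iverson bracket.
𝟏 : Bool → ℚ
𝟏 b = if b then 1ℚ else 0ℚ

0≤𝟏 : ∀ b → 0ℚ ≤ 𝟏 b
0≤𝟏 true  = 0≤1
0≤𝟏 false = ℚ.≤-refl

𝟏≤1 : ∀ b → 𝟏 b ≤ 1ℚ
𝟏≤1 true  = ℚ.≤-refl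
𝟏≤1 false = 0≤1

𝟏-∧ : ∀ a b → 𝟏 (a ∧ b) ≡ 𝟏 a * 𝟏 b
𝟏-∧ true  b = sym (ℚ.*-identityˡ (𝟏 b))
𝟏-∧ false b = sym (ℚ.*-zeroˡ (𝟏 b))

if≡𝟏* : ∀ b (c : ℚ) → (if b then c else 0ℚ) ≡ 𝟏 b * c
if≡𝟏* true  c = sym (ℚ.*-identityˡ c)
if≡𝟏* false c = sym (ℚ.*-zeroˡ c)

-- If a₁,…,a_k are drawn independently with weights w of total 1, then the bits
-- b(a₁),…,b(a_k) are independent, each 1 with probability ∑ w·b.
tuples-charℚ : ∀ {A : Set} (L : List A) (w : A → ℚ) (b : A → Bool) → ∑ L w ≡ 1ℚ →
  ∀ {k} (f : BoolFun k) →
  ∑ (tuples L k) (λ v → productℚ (Vec.map w v) * 𝟏 (f (Vec.map b v)))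
    ≡ charℚ f (∑ L (λ a → w a * 𝟏 (b a)))
tuples-charℚ L w b mass {zero} f with f []
... | true  = refl
... | false = refl
tuples-charℚ L w b mass {suc k} f = begin
  ∑ (tuples L (suc k)) _
    ≡⟨ ∑-cartesian _∷_ L (tuples L k) _ ⟩
  ∑ L (λ a → ∑ (tuples L k) (λ v → (w a * productℚ (Vec.map w v)) * 𝟏 (f (b a ∷ Vec.map b v))))
    ≡⟨ ∑-cong L (λ a → trans (∑-cong (tuples L k) (λ v → ℚ.*-assoc (w a) (productℚ (Vec.map w v)) _))
         (trans (∑-*ˡ (tuples L k) (w a) _)
                (cong (w a *_) (tuples-charℚ L w b mass (restrict (b a) f))))) ⟩
  ∑ L (λ a → w a * charℚ (restrict (b a) f) p)
    ≡⟨ ∑-cong L (λ a → split (w a) (b a)) ⟩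
  ∑ L (λ a → w a * F + (w a * 𝟏 (b a)) * (G - F))
    ≡⟨ ∑-+ L _ _ ⟩
  ∑ L (λ a → w a * F) + ∑ L (λ a → (w a * 𝟏 (b a)) * (G - F))
    ≡⟨ cong₂ _+_ (trans (∑-*ʳ L F w) (cong (_* F) mass)) (∑-*ʳ L (G - F) _) ⟩
  1ℚ * F + p * (G - F)
    ≡⟨ lem p F G ⟩
  (1ℚ - p) * F + p * G ∎
  where
  open ≡-Reasoning
  p = ∑ L (λ a → w a * 𝟏 (b a))
  F = charℚ (restrict false f) p
  G = charℚ (restrict true f) p
  lem : ∀ p F G → 1ℚ * F + p * (G - F) ≡ (1ℚ - p) * F + p * G
  lem = solve-∀ ringℚ
  lem-f : ∀ w F G → w * F ≡ w * F + (w * 0ℚ) * (G - F)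
  lem-f = solve-∀ ringℚ
  lem-t : ∀ w F G → w * G ≡ w * F + (w * 1ℚ) * (G - F)
  lem-t = solve-∀ ringℚ
  split : ∀ u c → u * charℚ (restrict c f) p ≡ u * F + (u * 𝟏 c) * (G - F)
  split u true  = lem-t u F G
  split u false = lem-f u F G

-- Sums over all Boolean functions

-- Maps that do not distinguish pointwise equal functions. Functions are listed up
-- to pointwise equality, so only such maps can be averaged reliably.
Respects≗ : ∀ {n} {B : Set} → (BoolFun n → B) → Set
Respects≗ φ = ∀ {f g} → f ≗ g → φ f ≡ φ g

-- Decided pointwise equality.
same : ∀ {n} → BoolFun n → BoolFun n → Bool
same f g = does (f ≗? g)

same-respects : ∀ {n} (f : BoolFun n) → Respects≗ (same f)
same-respects f {g} {h} g≗h = does-⇔ (mk⇔ (λ p x → trans (p x) (g≗h x)) (λ p x → trans (p x) (sym (g≗h x))))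
  (f ≗? g) (f ≗? h)

same-ite : ∀ {n} (h : BoolFun (suc n)) f g →
  same h (ite f g) ≡ same (restrict false h) f ∧ same (restrict true h) g
same-ite h f g = does-⇔
  (mk⇔ (λ p → (λ x → p (false ∷ x)) , (λ x → p (true ∷ x)))
       (λ { (p , q) (false ∷ x) → p x ; (p , q) (true ∷ x) → q x }))
  (h ≗? ite f g) ((restrict false h ≗? f) ×-dec (restrict true h ≗? g))

same-const : ∀ (h : BoolFun 0) b → same h (λ _ → b) ≡ does (h [] Bool.≟ b)
same-const h b = does-⇔ (mk⇔ (λ p → p []) (λ { p [] → p })) (h ≗? (λ _ → b)) (h [] Bool.≟ b)

-- h occurs exactly once, up to pointwise equality, among the listed functions.
∑-same : ∀ {n} (h : BoolFun n) → ∑ (functions n) (λ f → 𝟏 (same h f)) ≡ 1ℚ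
∑-same {zero} h rewrite same-const h false | same-const h true with h []
... | true  = refl
... | false = refl
∑-same {suc n} h = begin
  ∑ (functions (suc n)) (λ f → 𝟏 (same h f))
    ≡⟨ ∑-cartesian ite (functions n) (functions n) _ ⟩
  ∑ (functions n) (λ f → ∑ (functions n) (λ g → 𝟏 (same h (ite f g))))
    ≡⟨ ∑-cong (functions n) (λ f → ∑-cong (functions n) (λ g →
         trans (cong 𝟏 (same-ite h f g)) (𝟏-∧ (same (restrict false h) f) _))) ⟩
  ∑ (functions n) (λ f → ∑ (functions n) (λ g → 𝟏 (same (restrict false h) f) * 𝟏 (same (restrict true h) g)))
    ≡⟨ ∑-cong (functions n) (λ f → trans (∑-*ˡ (functions n) (𝟏 (same (restrict false h) f)) (λ g → 𝟏 (same (restrict true h) g)))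
         (trans (cong (𝟏 (same (restrict false h) f) *_) (∑-same (restrict true h)))
                (ℚ.*-identityʳ _))) ⟩
  ∑ (functions n) (λ f → 𝟏 (same (restrict false h) f))
    ≡⟨ ∑-same (restrict false h) ⟩
  1ℚ ∎
  where open ≡-Reasoning

∑-select : ∀ {n} (h : BoolFun n) (φ : BoolFun n → ℚ) → Respects≗ φ →
  ∑ (functions n) (λ f → 𝟏 (same h f) * φ f) ≡ φ h
∑-select {n} h φ resp = begin
  ∑ (functions n) (λ f → 𝟏 (same h f) * φ f)   ≡⟨ ∑-cong (functions n) only-h ⟩
  ∑ (functions n) (λ f → 𝟏 (same h f) * φ h)   ≡⟨ ∑-*ʳ (functions n) (φ h) _ ⟩
  ∑ (functions n) (λ f → 𝟏 (same h f)) * φ h   ≡⟨ cong (_* φ h) (∑-same h) ⟩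
  1ℚ * φ h                                     ≡⟨ ℚ.*-identityˡ (φ h) ⟩
  φ h                                          ∎
  where
  open ≡-Reasoning
  only-h′ : ∀ f (d : Dec (h ≗ f)) → 𝟏 (does d) * φ f ≡ 𝟏 (does d) * φ h
  only-h′ f (yes h≗f) = cong (1ℚ *_) (sym (resp h≗f))
  only-h′ f (no _)    = trans (ℚ.*-zeroˡ (φ f)) (sym (ℚ.*-zeroˡ (φ h)))
  only-h : ∀ f → 𝟏 (same h f) * φ f ≡ 𝟏 (same h f) * φ h
  only-h f = only-h′ f (h ≗? f)

-- The mean of φ under the distribution w.
expectation : ∀ {n} → (BoolFun n → ℚ) → (BoolFun n → ℚ) → ℚ
expectation {n} w φ = ∑ (functions n) (λ f → w f * φ f)

-- Pr[f(x) = 1] for f drawn from w.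
level : ∀ {n} → (BoolFun n → ℚ) → Vec Bool n → ℚ
level w x = expectation w (λ f → 𝟏 (f x))

-- The total probability.
mass : ∀ {n} → (BoolFun n → ℚ) → ℚ
mass {n} w = ∑ (functions n) w

-- The initial distribution

-- Sums indexed by Fin n.
∑ᶠ : ∀ {n} → (Fin n → ℚ) → ℚ
∑ᶠ {zero}  g = 0ℚ
∑ᶠ {suc n} g = g zero + ∑ᶠ (g ∘ suc)

∑ᶠ-zero : ∀ {n} {g : Fin n → ℚ} → (∀ j → g j ≡ 0ℚ) → ∑ᶠ g ≡ 0ℚ
∑ᶠ-zero {zero}  _ = refl
∑ᶠ-zero {suc n} z = trans (cong₂ _+_ (z zero) (∑ᶠ-zero (λ j → z (suc j)))) (ℚ.+-identityˡ 0ℚ)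

∑-∑ᶠ-swap : ∀ {A : Set} {n} (xs : List A) (g : Fin n → A → ℚ) →
  ∑ xs (λ x → ∑ᶠ (λ j → g j x)) ≡ ∑ᶠ (λ j → ∑ xs (g j))
∑-∑ᶠ-swap {n = zero}  xs g = ∑-zero xs
∑-∑ᶠ-swap {n = suc n} xs g = trans (∑-+ xs (g zero) _) (cong (_+_ (∑ xs (g zero))) (∑-∑ᶠ-swap xs (g ∘ suc)))

-- At most one of the alternatives holds, so the disjunction is counted by their sum.
𝟏-any : ∀ {n} {P : Fin n → Set} (P? : ∀ j → Dec (P j)) → (∀ {i j} → P i → P j → i ≡ j) →
  𝟏 (does (any? P?)) ≡ ∑ᶠ (λ j → 𝟏 (does (P? j)))
𝟏-any {zero}  P? _ = refl
𝟏-any {suc n} {P} P? unique with P? zero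
... | yes p = sym (trans (cong (_+_ 1ℚ) (∑ᶠ-zero none)) (ℚ.+-identityʳ 1ℚ))
  where
  none : ∀ j → 𝟏 (does (P? (suc j))) ≡ 0ℚ
  none j = cong 𝟏 (dec-false (P? (suc j)) (λ q → 0≢1+n (unique p q)))
... | no _ = trans (𝟏-any (P? ∘ suc) (λ p q → suc-injective (unique p q))) (sym (ℚ.+-identityˡ _))

projection-injective : ∀ {n} {f : BoolFun n} {i j} → f ≗ projection i → f ≗ projection j → i ≡ j
projection-injective {n} {f} {i} {j} f≗i f≗j with i ≟ᶠ j | value
  where
  -- The input on which projection i alone is true.
  unit : Vec Bool n
  unit = Vec.tabulate (λ l → does (i ≟ᶠ l))
  value : does (i ≟ᶠ j) ≡ true
  value = begin
    does (i ≟ᶠ j)        ≡⟨ Vec.lookup∘tabulate _ j ⟨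
    Vec.lookup unit j    ≡⟨ f≗j unit ⟨
    f unit               ≡⟨ f≗i unit ⟩
    Vec.lookup unit i    ≡⟨ Vec.lookup∘tabulate _ i ⟩
    does (i ≟ᶠ i)        ≡⟨ dec-true (i ≟ᶠ i) refl ⟩
    true                 ∎
    where open ≡-Reasoning
... | yes i≡j | _ = i≡j
... | no _    | ()

uniform-expectation : ∀ n .{{_ : NonZero n}} (φ : BoolFun n → ℚ) → Respects≗ φ →
  expectation (uniformProjections n) φ ≡ (+ 1 /ℚ n) * ∑ᶠ (λ j → φ (projection j))
uniform-expectation n φ resp = begin
  ∑ (functions n) (λ f → uniformProjections n f * φ f)
    ≡⟨ ∑-cong (functions n) (λ f → trans (cong (_* φ f) (as-sum f)) (lem r (∑ᶠ (λ j → 𝟏 (same (projection j) f))) (φ f))) ⟩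
  ∑ (functions n) (λ f → r * (∑ᶠ (λ j → 𝟏 (same (projection j) f)) * φ f))
    ≡⟨ ∑-*ˡ (functions n) r _ ⟩
  r * ∑ (functions n) (λ f → ∑ᶠ (λ j → 𝟏 (same (projection j) f)) * φ f)
    ≡⟨ cong (r *_) (∑-cong (functions n) (λ f → ∑ᶠ-*ʳ (φ f) (λ j → 𝟏 (same (projection j) f)))) ⟩
  r * ∑ (functions n) (λ f → ∑ᶠ (λ j → 𝟏 (same (projection j) f) * φ f))
    ≡⟨ cong (r *_) (∑-∑ᶠ-swap (functions n) (λ j f → 𝟏 (same (projection j) f) * φ f)) ⟩
  r * ∑ᶠ (λ j → ∑ (functions n) (λ f → 𝟏 (same (projection j) f) * φ f))
    ≡⟨ cong (r *_) (∑ᶠ-cong (λ j → ∑-select (projection j) φ resp)) ⟩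
  r * ∑ᶠ (λ j → φ (projection j)) ∎
  where
  open ≡-Reasoning
  r = + 1 /ℚ n
  lem : ∀ r s φ → (s * r) * φ ≡ r * (s * φ)
  lem = solve-∀ ringℚ
  ∑ᶠ-cong : ∀ {m} {g h : Fin m → ℚ} → (∀ j → g j ≡ h j) → ∑ᶠ g ≡ ∑ᶠ h
  ∑ᶠ-cong {zero}  _ = refl
  ∑ᶠ-cong {suc m} e = cong₂ _+_ (e zero) (∑ᶠ-cong (λ j → e (suc j)))
  ∑ᶠ-*ʳ : ∀ {m} c (g : Fin m → ℚ) → ∑ᶠ g * c ≡ ∑ᶠ (λ j → g j * c)
  ∑ᶠ-*ʳ {zero}  c g = ℚ.*-zeroˡ c
  ∑ᶠ-*ʳ {suc m} c g = trans (ℚ.*-distribʳ-+ c (g zero) _) (cong (_+_ (g zero * c)) (∑ᶠ-*ʳ c (g ∘ suc)))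
  same-sym : ∀ (f g : BoolFun n) → same f g ≡ same g f
  same-sym f g = does-⇔ (mk⇔ (λ p x → sym (p x)) (λ p x → sym (p x))) (f ≗? g) (g ≗? f)
  as-sum : ∀ f → uniformProjections n f ≡ ∑ᶠ (λ j → 𝟏 (same (projection j) f)) * r
  as-sum f = trans (if≡𝟏* (does (any? (λ j → f ≗? projection j))) r)
    (cong (_* r) (trans (𝟏-any (λ j → f ≗? projection j) (projection-injective {f = f}))
      (∑ᶠ-cong (λ j → cong 𝟏 (same-sym f (projection j))))))

∑ᶠ-weight : ∀ {n} (x : Vec Bool n) → ∑ᶠ (λ j → 𝟏 (projection j x)) ≡ fromℕ (weight x)
∑ᶠ-weight []          = refl
∑ᶠ-weight (true ∷ x)  = cong (_+_ 1ℚ) (∑ᶠ-weight x)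
∑ᶠ-weight (false ∷ x) = trans (ℚ.+-identityˡ _) (∑ᶠ-weight x)

uniform-level : ∀ n .{{_ : NonZero n}} x → level (uniformProjections n) x ≡ fromℕ (weight x) * (+ 1 /ℚ n)
uniform-level n x = trans (uniform-expectation n (λ f → 𝟏 (f x)) (λ f≗g → cong 𝟏 (f≗g x)))
  (trans (cong ((+ 1 /ℚ n) *_) (∑ᶠ-weight x)) (ℚ.*-comm (+ 1 /ℚ n) _))

uniform-mass : ∀ n .{{_ : NonZero n}} → mass (uniformProjections n) ≡ 1ℚ
uniform-mass n = begin
  mass (uniformProjections n)                         ≡⟨ ∑-cong (functions n) (λ f → ℚ.*-identityʳ _) ⟨
  expectation (uniformProjections n) (λ _ → 1ℚ)       ≡⟨ uniform-expectation n (λ _ → 1ℚ) (λ _ → refl) ⟩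
  (+ 1 /ℚ n) * ∑ᶠ {n} (λ _ → 1ℚ)                      ≡⟨ cong ((+ 1 /ℚ n) *_) (ones n) ⟩
  (+ 1 /ℚ n) * fromℕ n                                ≡⟨ 1/n*n n ⟩
  1ℚ                                                  ∎
  where
  open ≡-Reasoning
  ones : ∀ m → ∑ᶠ {m} (λ _ → 1ℚ) ≡ fromℕ m
  ones zero    = refl
  ones (suc m) = cong (_+_ 1ℚ) (ones m)

uniform-nonneg : ∀ n .{{_ : NonZero n}} f → 0ℚ ≤ uniformProjections n f
uniform-nonneg n f with does (any? (λ j → f ≗? projection j))
... | true  = ℚ.<⇒≤ (0<1/n n)
... | false = ℚ.≤-refl

uniform-respects : ∀ n .{{_ : NonZero n}} → Respects≗ (uniformProjections n)
uniform-respects n {f} {g} f≗g = cong (λ b → if b then + 1 /ℚ n else 0ℚ)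
  (does-⇔ (mk⇔ (λ { (j , p) → j , λ x → trans (sym (f≗g x)) (p x) })
               (λ { (j , p) → j , λ x → trans (f≗g x) (p x) }))
     (any? (λ j → f ≗? projection j)) (any? (λ j → g ≗? projection j)))

-- The growth process

module Growth {k n} (μ : BoolFun n → ℚ) (α : BoolFun k)
  (μ-nonneg : ∀ f → 0ℚ ≤ μ f) (μ-respects : Respects≗ μ) (μ-mass : mass μ ≡ 1ℚ) where

  productℚ-nonneg : ∀ {A : Set} {w : A → ℚ} → (∀ a → 0ℚ ≤ w a) →
    ∀ {j} (v : Vec A j) → 0ℚ ≤ productℚ (Vec.map w v)
  productℚ-nonneg 0≤w []      = 0≤1
  productℚ-nonneg 0≤w (a ∷ v) = 0≤* (0≤w a) (productℚ-nonneg 0≤w v)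

  growth-nonneg : ∀ i f → 0ℚ ≤ growth μ α i f
  growth-nonneg zero    f = μ-nonneg f
  growth-nonneg (suc i) f = ∑-nonneg (tuples (functions n) k) λ gs →
    subst (0ℚ ≤_) (sym (if≡𝟏* (same (compose α gs) f) _))
      (0≤* (0≤𝟏 (same (compose α gs) f)) (productℚ-nonneg (growth-nonneg i) gs))

  growth-respects : ∀ i → Respects≗ (growth μ α i)
  growth-respects zero            = μ-respects
  growth-respects (suc i) {f} {g} f≗g = ∑-cong (tuples (functions n) k) λ gs →
    cong (λ b → if b then productℚ (Vec.map (growth μ α i) gs) else 0ℚ)
         (same-respects (compose α gs) f≗g)

  -- A function of the next generation is drawn as α(g₁,…,g_k).
  growth-expectation : ∀ i (φ : BoolFun n → ℚ) → Respects≗ φ →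
    expectation (growth μ α (suc i)) φ
      ≡ ∑ (tuples (functions n) k) (λ gs → productℚ (Vec.map (growth μ α i) gs) * φ (compose α gs))
  growth-expectation i φ resp = begin
    ∑ F (λ f → ∑ T (λ gs → if same (compose α gs) f then Π gs else 0ℚ) * φ f)
      ≡⟨ ∑-cong F (λ f → sym (∑-*ʳ T (φ f) _)) ⟩
    ∑ F (λ f → ∑ T (λ gs → (if same (compose α gs) f then Π gs else 0ℚ) * φ f))
      ≡⟨ ∑-swap F T _ ⟩
    ∑ T (λ gs → ∑ F (λ f → (if same (compose α gs) f then Π gs else 0ℚ) * φ f))
      ≡⟨ ∑-cong T (λ gs → trans
           (∑-cong F (λ f → trans (cong (_* φ f) (if≡𝟏* (same (compose α gs) f) (Π gs)))
                                  (lem (𝟏 (same (compose α gs) f)) (Π gs) (φ f))))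
           (trans (∑-*ˡ F (Π gs) _) (cong (Π gs *_) (∑-select (compose α gs) φ resp)))) ⟩
    ∑ T (λ gs → Π gs * φ (compose α gs)) ∎
    where
    open ≡-Reasoning
    F = functions n
    T = tuples (functions n) k
    Π : Vec (BoolFun n) k → ℚ
    Π gs = productℚ (Vec.map (growth μ α i) gs)
    lem : ∀ s p φ → (s * p) * φ ≡ p * (s * φ)
    lem = solve-∀ ringℚ

  growth-mass : ∀ i → mass (growth μ α i) ≡ 1ℚ
  growth-mass zero    = μ-mass
  growth-mass (suc i) = begin
    mass (growth μ α (suc i))
      ≡⟨ ∑-cong (functions n) (λ f → ℚ.*-identityʳ _) ⟨
    expectation (growth μ α (suc i)) (λ _ → 1ℚ)
      ≡⟨ growth-expectation i (λ _ → 1ℚ) (λ _ → refl) ⟩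
    ∑ (tuples (functions n) k) (λ gs → productℚ (Vec.map (growth μ α i) gs) * 1ℚ)
      ≡⟨ tuples-charℚ (functions n) (growth μ α i) (λ _ → true) (growth-mass i) {k} (λ _ → true) ⟩
    charℚ {k} (λ _ → true) _
      ≡⟨ charℚ-true {k} (λ _ → true) _ (λ _ → refl) ⟩
    1ℚ ∎
    where open ≡-Reasoning

  -- The bits g₁(x),…,g_k(x) are independent with the same probability of being 1.
  growth-level : ∀ i x → level (growth μ α (suc i)) x ≡ charℚ α (level (growth μ α i) x)
  growth-level i x = trans
    (growth-expectation i (λ f → 𝟏 (f x)) (λ f≗g → cong 𝟏 (f≗g x)))
    (tuples-charℚ (functions n) (growth μ α i) (λ g → g x) (growth-mass i) α)

-- Concentration of a distribution on one function

module Concentration {n} (w : BoolFun n → ℚ) (w-nonneg : ∀ f → 0ℚ ≤ w f)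
  (w-respects : Respects≗ w) (w-mass : mass w ≡ 1ℚ) where

  expectation-mono : ∀ {φ ψ} → (∀ f → φ f ≤ ψ f) → expectation w φ ≤ expectation w ψ
  expectation-mono φ≤ψ = ∑-mono (functions n) (λ f → *-monoˡ (w-nonneg f) (φ≤ψ f))

  expectation-same : ∀ h → expectation w (λ f → 𝟏 (same h f)) ≡ w h
  expectation-same h = trans (∑-cong (functions n) (λ f → ℚ.*-comm (w f) _)) (∑-select h w w-respects)

  expectation-one : expectation w (λ _ → 1ℚ) ≡ 1ℚ
  expectation-one = trans (∑-cong (functions n) (λ f → ℚ.*-identityʳ (w f))) w-mass

  expectation-+ : ∀ φ ψ → expectation w (λ f → φ f + ψ f) ≡ expectation w φ + expectation w ψ
  expectation-+ φ ψ = trans (∑-cong (functions n) (λ f → ℚ.*-distribˡ-+ (w f) (φ f) (ψ f)))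
    (∑-+ (functions n) _ _)

  probability≤1 : ∀ f → w f ≤ 1ℚ
  probability≤1 f = subst₂ _≤_ (expectation-same f) expectation-one (expectation-mono bound)
    where
    bound : ∀ g → 𝟏 (same f g) ≤ 1ℚ
    bound g = 𝟏≤1 (same f g)

  distinct-sum≤1 : ∀ f h → ¬ (f ≗ h) → w f + w h ≤ 1ℚ
  distinct-sum≤1 f h f≉h = subst₂ _≤_
    (trans (expectation-+ (λ g → 𝟏 (same f g)) (λ g → 𝟏 (same h g)))
           (cong₂ _+_ (expectation-same f) (expectation-same h)))
    expectation-one (expectation-mono bound)
    where
    bound′ : ∀ g (d : Dec (f ≗ g)) (e : Dec (h ≗ g)) → 𝟏 (does d) + 𝟏 (does e) ≤ 1ℚ
    bound′ g (yes p) (yes q) = ⊥-elim (f≉h (λ x → trans (p x) (sym (q x))))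
    bound′ g (yes _) (no _)  = ℚ.≤-refl
    bound′ g (no _)  (yes _) = ℚ.≤-refl
    bound′ g (no _)  (no _)  = 0≤1
    bound : ∀ g → 𝟏 (same f g) + 𝟏 (same h g) ≤ 1ℚ
    bound g = bound′ g (f ≗? g) (h ≗? g)

  -- Pr[f(x) ≠ h(x)] for f drawn from w.
  error : BoolFun n → Vec Bool n → ℚ
  error h x = if h x then 1ℚ - level w x else level w x

  expectation-xor : ∀ h x → expectation w (λ f → 𝟏 (h x xor f x)) ≡ error h x
  expectation-xor h x with h x
  ... | false = refl
  ... | true  = begin
    expectation w (λ f → 𝟏 (not (f x)))
      ≡⟨ lem (expectation w (λ f → 𝟏 (not (f x)))) (level w x) ⟩
    (expectation w (λ f → 𝟏 (not (f x))) + level w x) - level w x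
      ≡⟨ cong (_- level w x) (expectation-+ (λ f → 𝟏 (not (f x))) (λ f → 𝟏 (f x))) ⟨
    expectation w (λ f → 𝟏 (not (f x)) + 𝟏 (f x)) - level w x
      ≡⟨ cong (_- level w x) (∑-cong (functions n) (λ f → cong (w f *_) (one (f x)))) ⟩
    expectation w (λ _ → 1ℚ) - level w x
      ≡⟨ cong (_- level w x) expectation-one ⟩
    1ℚ - level w x ∎
    where
    open ≡-Reasoning
    lem : ∀ a b → a ≡ (a + b) - b
    lem = solve-∀ ringℚ
    one : ∀ b → 𝟏 (not b) + 𝟏 b ≡ 1ℚ
    one true  = refl
    one false = refl

  -- A function is either h or differs from h at some input.
  union-bound : ∀ h → 1ℚ ≤ w h + ∑ (inputs n) (error h)
  union-bound h = subst₂ _≤_ expectation-one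
    (trans (expectation-+ (λ f → 𝟏 (same h f)) _) (cong₂ _+_ (expectation-same h) errors))
    (expectation-mono bound)
    where
    xor-≢ : ∀ a b → ¬ (a ≡ b) → 𝟏 (a xor b) ≡ 1ℚ
    xor-≢ true  true  a≢b = ⊥-elim (a≢b refl)
    xor-≢ true  false _   = refl
    xor-≢ false true  _   = refl
    xor-≢ false false a≢b = ⊥-elim (a≢b refl)
    -- Either f agrees with h on xs, or a difference is counted.
    scan : (f : BoolFun n) (xs : List (Vec Bool n)) → All (λ x → h x ≡ f x) xs ⊎ 1ℚ ≤ ∑ xs (λ x → 𝟏 (h x xor f x))
    scan f []       = inj₁ []
    scan f (x ∷ xs) with h x Bool.≟ f x | scan f xs
    ... | yes p | inj₁ ps = inj₁ (p ∷ ps)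
    ... | no ¬p | _       = inj₂ (≤-excess (∑ xs (λ x → 𝟏 (h x xor f x))) (∑-nonneg xs (λ x → 0≤𝟏 (h x xor f x)))
                                  (cong (λ u → u + ∑ xs (λ x → 𝟏 (h x xor f x))) (xor-≢ (h x) (f x) ¬p)))
    ... | yes _ | inj₂ q  = inj₂ (ℚ.≤-trans q (≤-excess (𝟏 (h x xor f x)) (0≤𝟏 (h x xor f x)) (ℚ.+-comm (𝟏 (h x xor f x)) _)))
    bound′ : ∀ f (d : Dec (h ≗ f)) →
      1ℚ ≤ 𝟏 (does d) + ∑ (inputs n) (λ x → 𝟏 (h x xor f x))
    bound′ f (yes _) = ≤-excess _ (∑-nonneg (inputs n) (λ x → 0≤𝟏 (h x xor f x))) refl
    bound′ f (no h≉f) with scan f (inputs n)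
    ... | inj₁ p = ⊥-elim (h≉f (λ x → All.lookup p (∈-inputs x)))
    ... | inj₂ q = subst (1ℚ ≤_) (sym (ℚ.+-identityˡ _)) q
    bound : ∀ f → 1ℚ ≤ 𝟏 (same h f) + ∑ (inputs n) (λ x → 𝟏 (h x xor f x))
    bound f = bound′ f (h ≗? f)
    errors : expectation w (λ f → ∑ (inputs n) (λ x → 𝟏 (h x xor f x))) ≡ ∑ (inputs n) (error h)
    errors = trans (∑-cong (functions n) (λ f → sym (∑-*ˡ (inputs n) (w f) _)))
      (trans (∑-swap (functions n) (inputs n) _) (∑-cong (inputs n) (expectation-xor h)))

-- From the real formulation to rational sequences

seq-sumℝ : ∀ {A : Set} (xs : List A) (g : A → ℝ) i → seq (sumℝ (map g xs)) i ≡ ∑ xs (λ x → seq (g x) i)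
seq-sumℝ []       g i = refl
seq-sumℝ (x ∷ xs) g i = cong (_+_ (seq (g x) i)) (seq-sumℝ xs g i)

∑-inputs : ∀ {k} (g : Vec Bool (suc k) → ℚ) →
  ∑ (inputs (suc k)) g ≡ ∑ (inputs k) (λ x → g (false ∷ x)) + ∑ (inputs k) (λ x → g (true ∷ x))
∑-inputs {k} g = trans (∑-cartesian _∷_ (false ∷ true ∷ []) (inputs k) g)
  (cong (_+_ (∑ (inputs k) (λ x → g (false ∷ x)))) (ℚ.+-identityʳ _))

-- Pr[(X₁,…,X_k) = x] at a rational p.
bernoulliℚ : ∀ {k} → ℚ → Vec Bool k → ℚ
bernoulliℚ p []      = 1ℚ
bernoulliℚ p (b ∷ x) = (if b then p else 1ℚ - p) * bernoulliℚ p x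

seq-bernoulli : ∀ {k} t (x : Vec Bool k) i → seq (bernoulli t x) i ≡ bernoulliℚ (seq t i) x
seq-bernoulli t []          i = refl
seq-bernoulli t (true ∷ x)  i = cong (seq t i *_) (seq-bernoulli t x i)
seq-bernoulli t (false ∷ x) i = cong ((1ℚ - seq t i) *_) (seq-bernoulli t x i)

∑-bernoulli : ∀ {k} (f : BoolFun k) p → ∑ (inputs k) (λ x → 𝟏 (f x) * bernoulliℚ p x) ≡ charℚ f p
∑-bernoulli {zero} f p with f []
... | true  = refl
... | false = refl
∑-bernoulli {suc k} f p = trans (∑-inputs {k} (λ x → 𝟏 (f x) * bernoulliℚ p x))
  (cong₂ _+_ (half false (1ℚ - p) (λ _ → refl)) (half true p (λ _ → refl)))
  where
  lem : ∀ u v w → u * (v * w) ≡ v * (u * w)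
  lem = solve-∀ ringℚ
  half : ∀ b r → (∀ x → bernoulliℚ p (b ∷ x) ≡ r * bernoulliℚ p x) →
    ∑ (inputs k) (λ x → 𝟏 (f (b ∷ x)) * bernoulliℚ p (b ∷ x)) ≡ r * charℚ (restrict b f) p
  half b r split = trans
    (∑-cong (inputs k) (λ x → trans (cong (𝟏 (f (b ∷ x)) *_) (split x)) (lem (𝟏 (f (b ∷ x))) r (bernoulliℚ p x))))
    (trans (∑-*ˡ (inputs k) r _) (cong (r *_) (∑-bernoulli (restrict b f) p)))

seq-characteristic : ∀ {k} (f : BoolFun k) t i → seq (characteristic f t) i ≡ charℚ f (seq t i)
seq-characteristic {k} f t i = trans
  (seq-sumℝ (inputs k) (λ x → if f x then bernoulli t x else 0ℝ) i)
  (trans (∑-cong (inputs k) term) (∑-bernoulli f (seq t i)))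
  where
  term : ∀ x → seq (if f x then bernoulli t x else 0ℝ) i ≡ 𝟏 (f x) * bernoulliℚ (seq t i) x
  term x with f x
  ... | true  = trans (seq-bernoulli t x i) (sym (ℚ.*-identityˡ _))
  ... | false = sym (ℚ.*-zeroˡ (bernoulliℚ (seq t i) x))

length-filter-map : ∀ {A B : Set} {P : B → Set} (P? : Decidable P) (h : A → B) xs →
  length (filter P? (map h xs)) ≡ length (filter (P? ∘ h) xs)
length-filter-map P? h []       = refl
length-filter-map P? h (x ∷ xs) with does (P? (h x))
... | true  = cong suc (length-filter-map P? h xs)
... | false = length-filter-map P? h xs

-- Links trues to the count in the definition of balance.
trues-count : ∀ {k} (f : BoolFun k) → length (filter (λ x → f x Bool.≟ true) (inputs k)) ≡ trues f
trues-count {zero} f with f []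
... | true  = refl
... | false = refl
trues-count {suc k} f = begin
  length (filter P? (map (false ∷_) (inputs k) ++ map (true ∷_) (inputs k) ++ []))
    ≡⟨ cong length (List.filter-++ P? (map (false ∷_) (inputs k)) _) ⟩
  length (filter P? (map (false ∷_) (inputs k)) ++ filter P? (map (true ∷_) (inputs k) ++ []))
    ≡⟨ List.length-++ (filter P? (map (false ∷_) (inputs k))) ⟩
  length (filter P? (map (false ∷_) (inputs k))) ℕ.+ length (filter P? (map (true ∷_) (inputs k) ++ []))
    ≡⟨ cong₂ ℕ._+_ (half false)
         (trans (cong (λ xs → length (filter P? xs)) (List.++-identityʳ (map (true ∷_) (inputs k)))) (half true)) ⟩
  trues (restrict false f) ℕ.+ trues (restrict true f)
    ≡⟨ cong₂ ℕ._+_ (ℕ.*-identityˡ (trues (restrict false f))) (ℕ.*-identityˡ (trues (restrict true f))) ⟨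
  1 ℕ.* trues (restrict false f) ℕ.+ 1 ℕ.* trues (restrict true f) ∎
  where
  open ≡-Reasoning
  P? = λ x → f x Bool.≟ true
  half : ∀ b → length (filter P? (map (b ∷_) (inputs k))) ≡ trues (restrict b f)
  half b = trans (length-filter-map P? (b ∷_) (inputs k)) (trues-count (restrict b f))

0<⊓ : ∀ {a b} → 0ℚ < a → 0ℚ < b → 0ℚ < a ⊓ b
0<⊓ {a} {b} 0<a 0<b with ℚ.⊓-sel a b
... | inj₁ e = subst (0ℚ <_) (sym e) 0<a
... | inj₂ e = subst (0ℚ <_) (sym e) 0<b

-- The hypotheses on t, read off from its Cauchy sequence.
characteristic-approaches : ∀ {k} (α : BoolFun k) t → 0ℝ <ℝ t → t <ℝ 1ℝ →
  characteristic α t ≃ℝ t → ApproachesFixedPoint α (seq t)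
characteristic-approaches α t (δ₁ , 0<δ₁ , N₁ , h₁) (δ₂ , 0<δ₂ , N₂ , h₂) fix = record
  { δ = δ₁ ⊓ δ₂
  ; 0<δ = 0<⊓ 0<δ₁ 0<δ₂
  ; from = N₁ ℕ.⊔ N₂
  ; δ≤s = λ i i≥ → ℚ.≤-trans (ℚ.p⊓q≤p δ₁ δ₂) (subst (_≤ seq t i) (ℚ.+-identityˡ δ₁)
      (ℚ.<⇒≤ (h₁ i (ℕ.m⊔n≤o⇒m≤o N₁ N₂ i≥))))
  ; s≤1-δ = λ i i≥ → ≤-excess (1ℚ - (seq t i + δ₁ ⊓ δ₂))
      (≤⇒0≤- (ℚ.≤-trans (ℚ.+-monoʳ-≤ (seq t i) (ℚ.p⊓q≤q δ₁ δ₂))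
        (ℚ.<⇒≤ (h₂ i (ℕ.m⊔n≤o⇒n≤o N₁ N₂ i≥)))))
      (lem (seq t i) (δ₁ ⊓ δ₂))
  ; fixed = λ ε 0<ε → let N , h = fix ε 0<ε in N , λ i i≥ →
      subst (λ c → ∣ c - seq t i ∣ < ε) (seq-characteristic α t i) (h i i≥)
  }
  where
  lem : ∀ s d → 1ℚ - d ≡ s + (1ℚ - (s + d))
  lem = solve-∀ ringℚ

strict-gap : ∀ {a b} → a < b → ∃[ ε ] (0ℚ < ε × a + ε < b)
strict-gap {a} {b} a<b = ½ * (b - a) , 0<h , <-excess (½ * (b - a)) 0<h
  (sym (trans (ℚ.+-assoc a _ _) (trans (cong (_+_ a) (sym (ℚ.*-distribʳ-+ (b - a) ½ ½))) (lem a b))))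
  where
  0<h : 0ℚ < ½ * (b - a)
  0<h = 0<* (ℚ.positive⁻¹ ½) (<⇒0<- a<b)
  lem : ∀ a b → a + 1ℚ * (b - a) ≡ b
  lem = solve-∀ ringℚ

-- The conditions say m/n < t < (m + 1)/n, the second through 1 - t.
ceiling : ∀ n .{{_ : NonZero n}} m (t : ℝ) (let r = + 1 /ℚ n) →
  StrictlyBelow (fromℕ m * r) (seq t) →
  StrictlyBelow (1ℚ - fromℕ (suc m) * r) (λ i → 1ℚ - seq t i) →
  IsCeiling (t *ℝ fromℤ (+ n)) (+ suc m)
ceiling n m t (ε , 0<ε , N , h) (ε′ , 0<ε′ , N′ , h′) = upper , lower
  where
  r = + 1 /ℚ n
  ν = fromℕ n
  ν≡ : ν ≡ + n /ℚ 1
  ν≡ = fromℕ≡/1 n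
  0<ν : 0ℚ < ν
  0<ν = ℚ.<-≤-trans 0<1 (fromℕ-mono {1} {n} (ℕ.>-nonZero⁻¹ n))
  rν : r * ν ≡ 1ℚ
  rν = 1/n*n n
  upper : (t *ℝ fromℤ (+ n)) ≤ℝ fromℤ (+ suc m)
  upper (η , 0<η , M , g) = ℚ.<-asym sν<m m<sν
    where
    i = M ℕ.⊔ N′
    s = seq t i
    m<sν : fromℕ (suc m) < s * ν
    m<sν = ℚ.<-trans (<-excess η 0<η refl)
      (subst₂ (λ u v → u + η < s * v) (sym (fromℕ≡/1 (suc m))) (sym ν≡) (g i (ℕ.m≤m⊔n M N′)))
    lem₁ : ∀ a s e → (1ℚ - s) - ((1ℚ - a) + e) + e ≡ a - s
    lem₁ = solve-∀ ringℚ
    s<mr : 0ℚ < fromℕ (suc m) * r - s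
    s<mr = subst (0ℚ <_) (lem₁ (fromℕ (suc m) * r) s ε′)
      (ℚ.+-mono-<-≤ (<⇒0<- (h′ i (ℕ.m≤n⊔m M N′))) (ℚ.<⇒≤ 0<ε′))
    lem₂ : ∀ a r s v → (a * r - s) * v ≡ a * (r * v) - s * v
    lem₂ = solve-∀ ringℚ
    sν<m : s * ν < fromℕ (suc m)
    sν<m = 0<-⇒< (subst (0ℚ <_)
      (trans (lem₂ (fromℕ (suc m)) r s ν)
        (cong (_- s * ν) (trans (cong (fromℕ (suc m) *_) rν) (ℚ.*-identityʳ (fromℕ (suc m))))))
      (0<* s<mr 0<ν))
  lower : fromℤ (+ suc m) <ℝ (t *ℝ fromℤ (+ n)) +ℝ 1ℝ
  lower = ε * ν , 0<* 0<ε 0<ν , N , λ i i≥ →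
    subst₂ (λ u v → u + ε * ν < seq t i * v + 1ℚ) (fromℕ≡/1 (suc m)) ν≡
      (0<-⇒< (subst (0ℚ <_)
        (trans (lem (fromℕ m) r (seq t i) ε ν)
          (cong (λ u → (seq t i * ν + 1ℚ) - ((1ℚ + u) + ε * ν))
            (trans (cong (fromℕ m *_) rν) (ℚ.*-identityʳ (fromℕ m)))))
        (0<* (<⇒0<- (h i i≥)) 0<ν)))
    where
    lem : ∀ a r s e v → (s - (a * r + e)) * v ≡ (s * v + 1ℚ) - ((1ℚ + a * (r * v)) + e * v)
    lem = solve-∀ ringℚ

weight≤n : ∀ {n} (x : Vec Bool n) → weight x ℕ.≤ n
weight≤n x = Vec.count≤n (Bool._≟ true) x

-- If m/n is carried to 0 and (m + 1)/n to 1, then the probability of the threshold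
-- function at m + 1 tends to 1.
concentration : ∀ k n .{{_ : NonZero n}} (α : BoolFun k) → Monotone α →
  α (zeros k) ≡ false → dual α (zeros k) ≡ false →
  ∀ m (let r = + 1 /ℚ n) → suc m ℕ.≤ n →
  Subcritical α (fromℕ m * r) → Subcritical (dual α) (1ℚ - fromℕ (suc m) * r) →
  ∀ ε → 0ℚ < ε → ∃[ N ] (∀ i → N ℕ.≤ i →
    1ℚ - ε < growth (uniformProjections n) α i (threshold (suc m)))
concentration k n α mono α0 α*0 m m<n sub sub* ε 0<ε = N , λ i i≥ → bound i i≥
  where
  r = + 1 /ℚ n
  T = threshold {n} (suc m)
  open Growth (uniformProjections n) α (uniform-nonneg n) (uniform-respects n) (uniform-mass n)
  π : ℕ → BoolFun n → ℚ
  π = growth (uniformProjections n) α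
  module C i = Concentration (π i) (growth-nonneg i) (growth-respects i) (growth-mass i)
  L = fromℕ (length (inputs n))
  c₁ = proj₂ (subcritical⇒contracts α mono α0 sub)
  c₂ = proj₂ (subcritical⇒contracts (dual α) (dual-monotone {f = α} mono) α*0 sub*)
  ρ = + 1 /ℚ suc (length (inputs n))
  0<ρ : 0ℚ < ρ
  0<ρ = 0<1/n (suc (length (inputs n)))
  ρL : ρ * (1ℚ + L) ≡ 1ℚ
  ρL = 1/n*n (suc (length (inputs n)))
  -- A bound ε/(L + 1) on each of the L errors makes their sum less than ε.
  η = ε * ρ
  0<η : 0ℚ < η
  0<η = 0<* 0<ε 0<ρ
  N₁ = proj₁ (harmonic-decay (proj₁ c₁) 0<η)
  N₂ = proj₁ (harmonic-decay (proj₁ c₂) 0<η)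
  N = N₁ ℕ.⊔ N₂
  0<r : 0ℚ < r
  0<r = 0<1/n n
  grid-mono : ∀ {a b} → a ℕ.≤ b → fromℕ a * r ≤ fromℕ b * r
  grid-mono a≤b = *-monoʳ (ℚ.<⇒≤ 0<r) (fromℕ-mono a≤b)
  grid≤1 : ∀ {a} → a ℕ.≤ n → fromℕ a * r ≤ 1ℚ
  grid≤1 {a} a≤n = subst (fromℕ a * r ≤_) (trans (ℚ.*-comm (fromℕ n) r) (1/n*n n)) (grid-mono a≤n)
  level-𝕀 : ∀ i x → 𝕀 (level (π i) x)
  level-𝕀 zero x = subst 𝕀 (sym (uniform-level n x))
    (0≤* (0≤fromℕ (weight x)) (ℚ.<⇒≤ 0<r) , grid≤1 (weight≤n x))
  level-𝕀 (suc i) x = subst 𝕀 (sym (growth-level i x)) (charℚ-𝕀 α (level-𝕀 i x))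
  below : ∀ x → weight x ℕ.≤ m → ∀ i → N ℕ.≤ i → level (π i) x < η
  below x w≤m i i≥ = proj₂ (harmonic-decay (proj₁ c₁) 0<η) i (ℕ.m⊔n≤o⇒m≤o N₁ N₂ i≥) _
    (proj₂ (iterate-bound α c₁ (λ j → level (π j) x) (λ j → proj₁ (level-𝕀 j x)) (λ j → growth-level j x)
      (subst (_≤ fromℕ m * r) (sym (uniform-level n x)) (grid-mono w≤m))
      (grid≤1 (ℕ.≤-trans (ℕ.n≤1+n m) m<n)) i))
  above : ∀ x → suc m ℕ.≤ weight x → ∀ i → N ℕ.≤ i → 1ℚ - level (π i) x < η
  above x m<w i i≥ = proj₂ (harmonic-decay (proj₁ c₂) 0<η) i (ℕ.m⊔n≤o⇒n≤o N₁ N₂ i≥) _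
    (proj₂ (iterate-bound (dual α) c₂ (λ j → 1ℚ - level (π j) x)
      (λ j → proj₁ (1-𝕀 (level-𝕀 j x)))
      (λ j → trans (cong (λ p → 1ℚ - p) (growth-level j x)) (sym (charℚ-dual α (level (π j) x))))
      (subst (λ p → 1ℚ - p ≤ 1ℚ - fromℕ (suc m) * r) (sym (uniform-level n x))
        (ℚ.+-monoʳ-≤ 1ℚ (ℚ.neg-antimono-≤ (grid-mono m<w))))
      (proj₂ (1-𝕀 (0≤* (0≤fromℕ (suc m)) (ℚ.<⇒≤ 0<r) , grid≤1 m<n))) i))
  error≤η : ∀ i → N ℕ.≤ i → ∀ x → C.error i T x ≤ η
  error≤η i i≥ x = by-threshold (suc m ℕ.≤? weight x)
    where
    by-threshold : (d : Dec (suc m ℕ.≤ weight x)) →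
      (if does d then 1ℚ - level (π i) x else level (π i) x) ≤ η
    by-threshold (yes m<w) = ℚ.<⇒≤ (above x m<w i i≥)
    by-threshold (no m≮w)  = ℚ.<⇒≤ (below x (ℕ.≤-pred (ℕ.≰⇒> m≮w)) i i≥)
  bound : ∀ i → N ℕ.≤ i → 1ℚ - ε < π i T
  bound i i≥ = 0<-⇒< (subst (0ℚ <_) (lem₂ (π i T) ε ρ L)
    (ℚ.+-mono-<-≤ (subst (λ u → 0ℚ < η + ε * (1ℚ - u)) (sym ρL) (subst (0ℚ <_) (lem₁ η ε) 0<η))
      (≤⇒0≤- (ℚ.≤-trans (C.union-bound i T) (ℚ.+-monoʳ-≤ (π i T)
        (ℚ.≤-trans (∑-mono (inputs n) (error≤η i i≥)) (ℚ.≤-reflexive (∑-const (inputs n) η))))))))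
    where
    lem₁ : ∀ η ε → η ≡ η + ε * (1ℚ - 1ℚ)
    lem₁ = solve-∀ ringℚ
    lem₂ : ∀ p ε ρ L → (ε * ρ + ε * (1ℚ - ρ * (1ℚ + L))) + ((p + L * (ε * ρ)) - 1ℚ) ≡ p - (1ℚ - ε)
    lem₂ = solve-∀ ringℚ

-- A sequence of distributions in which the probability of T tends to 1 converges to
-- the point mass at T.
limit : ∀ {n} (T : BoolFun n) (w : ℕ → BoolFun n → ℚ) → (∀ i f → 0ℚ ≤ w i f) →
  (∀ i → Respects≗ (w i)) → (∀ i → mass (w i) ≡ 1ℚ) →
  (∀ ε → 0ℚ < ε → ∃[ N ] (∀ i → N ℕ.≤ i → 1ℚ - ε < w i T)) →
  ∃[ π ] (IsLimitingDistribution w π × ConcentratedOn π T)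
limit {n} T w nonneg resp total conv = (λ f → point (f ≗? T)) ,
  (λ f → converges f (f ≗? T)) , concentrated (T ≗? T)
  where
  point : ∀ {f} → Dec (f ≗ T) → ℝ
  point d = if does d then 1ℝ else 0ℝ
  module C i = Concentration (w i) (nonneg i) (resp i) (total i)
  close : ∀ {a b} → a < b → fromℚ a <ℝ fromℚ b
  close a<b = let ε , 0<ε , a+ε<b = strict-gap a<b in ε , 0<ε , 0 , λ _ _ → a+ε<b
  converges : ∀ f (d : Dec (f ≗ T)) → ConvergesTo (λ i → w i f) (point d)
  converges f (yes f≗T) ε 0<ε with conv ε 0<ε
  ... | N , h = N , λ i i≥ →
    close (subst (1ℚ - ε <_) (sym (resp i f≗T)) (h i i≥)) ,
    close (ℚ.≤-<-trans (C.probability≤1 i f) (<-excess ε 0<ε refl))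
  converges f (no f≉T) ε 0<ε with conv ε 0<ε
  ... | N , h = N , λ i i≥ →
    close {0ℚ - ε} (ℚ.<-≤-trans (<-excess ε 0<ε (lem₁ ε)) (nonneg i f)) ,
    close (0<-⇒< (subst (0ℚ <_) (lem₂ (w i f) (w i T) ε)
      (ℚ.+-mono-<-≤ (<⇒0<- (h i i≥)) (≤⇒0≤- (C.distinct-sum≤1 i f T f≉T)))))
    where
    lem₁ : ∀ ε → 0ℚ ≡ (0ℚ - ε) + ε
    lem₁ = solve-∀ ringℚ
    lem₂ : ∀ a b ε → (b - (1ℚ - ε)) + (1ℚ - (a + b)) ≡ (0ℚ + ε) - a
    lem₂ = solve-∀ ringℚ
  concentrated : (d : Dec (T ≗ T)) → point d ≃ℝ 1ℝ
  concentrated (yes _) ε 0<ε = 0 , λ _ _ → 0<ε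
  concentrated (no T≉T)      = ⊥-elim (T≉T (λ _ → refl))

theorem5p4 : ∀ (k n : ℕ) .{{_ : NonZero n}} (α : BoolFun k) →
    Monotone α →
    Unbalanced α →
    (t : ℝ) →
    0ℝ <ℝ t →
    t <ℝ 1ℝ →
    characteristic α t ≃ℝ t →
    ∃[ m ] IsCeiling (t *ℝ fromℤ (+ n)) (+ m) ×
    (∃[ π ] IsLimitingDistribution (growth (uniformProjections n) α) π ×
    ConcentratedOn π (threshold m))
theorem5p4 k n α mono unbal t 0<t t<1 fix =
  let m , m<n , sub , sub* = crossing {λ w → Subcritical α (fromℕ w * r)}
        {λ w → Subcritical (dual α) (1ℚ - fromℕ w * r)} n
        (inj₁ (ℚ.*-zeroˡ r)) (inj₁ (trans (cong (λ p → 1ℚ - p) nr) (ℚ.+-inverseʳ 1ℚ)))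
        (λ w w≤n → subcritical-or-dual α mono α0 α*0
          (λ even → unbal (trans (cong (2 ℕ.*_) (trues-count α)) even))
          (0≤* (0≤fromℕ w) (ℚ.<⇒≤ 0<r)
          , subst (fromℕ w * r ≤_) nr (*-monoʳ (ℚ.<⇒≤ 0<r) (fromℕ-mono w≤n))))
  in suc m
   , ceiling n m t (subcritical⇒below α mono α0 A sub)
       (subcritical⇒below (dual α) (dual-monotone {f = α} mono) α*0 (dual-approaches A) sub*)
   , limit (threshold (suc m)) (growth (uniformProjections n) α)
       growth-nonneg growth-respects growth-mass
       (concentration k n α mono α0 α*0 m m<n sub sub*)
  where
  r = + 1 /ℚ n
  open Growth (uniformProjections n) α (uniform-nonneg n) (uniform-respects n) (uniform-mass n)
  0<r : 0ℚ < r
  0<r = 0<1/n n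
  nr : fromℕ n * r ≡ 1ℚ
  nr = trans (ℚ.*-comm (fromℕ n) r) (1/n*n n)
  A = characteristic-approaches α t 0<t t<1 fix
  α0 = approaches⇒zeros-false α mono A
  α*0 = approaches⇒zeros-false (dual α) (dual-monotone {f = α} mono) (dual-approaches A)
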